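{- Let $k\ge0$, let $T$ be a semi-classical arithmetic, and let $X$ be a set of sentences of the language of $\mathsf{HA}$ all belonging to $\mathcal{Q}_{k+1}$. The following are pairwise equivalent: (1) $\mathsf{PA}+X$ is $(\Pi_{k+1}\lor\Pi_{k+1})$-conservative over $T+X$; (2) $T+X$ is closed under $\mathrm{DNE\text{ - }R}(\Pi_{k+1}\lor\Pi_{k+1})$; (3) $T+X$ is closed under $\mathrm{CD\text{ - }R}(\Pi_{k+1})$; (4) $T+X$ is closed under $\mathrm{DMLD\text{ - }R}(\Sigma_{k+1})$; (5) $T+X$ is closed under $\mathrm{DML\text{ - }R}(\Sigma_{k+1})$ and $T+X\vdash\mathrm{DNE}(\Sigma_k)$.
   Context: $\mathsf{HA}$ is intuitionistic first-order arithmetic with function symbols for all primitive recursive functions and logical constants $\forall,\exists,\to,\land,\lor,\perp$ ($\neg\varphi:\equiv\varphi\to\perp$); $\mathsf{PA}$ is $\mathsf{HA}$ plus excluded middle for all formulas. A semi-classical arithmetic is a theory $T$ in the language of $\mathsf{HA}$ with $\mathsf{HA}\subseteq T\subseteq\mathsf{PA}$; $T+X$ adds the sentences of $X$ as axioms. $T'$ is $\Gamma$-conservative over $T$ if every formula of $\Gamma$ provable in $T'$ is provable in $T$. $\Sigma_0=\Pi_0$ = quantifier-free formulas; $\Sigma_{k+1}$ = formulas $\exists x_1\cdots\exists x_n\varphi$, $\varphi\in\Pi_k$; $\Pi_{k+1}$ = formulas $\forall x_1\cdots\forall x_n\varphi$, $\varphi\in\Sigma_k$. $\Pi_{k+1}\lor\Pi_{k+1}$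 = formulas $\varphi\lor\psi$ with $\varphi,\psi\in\Pi_{k+1}$. $\mathrm{DNE}(\Sigma_k)$ is the scheme $\neg\neg\varphi\to\varphi$ for $\varphi\in\Sigma_k$. Dual of a prenex formula: $\varphi^\perp:\equiv\neg\varphi$ for quantifier-free $\varphi$; $(\forall x\varphi)^\perp:\equiv\exists x\varphi^\perp$; $(\exists x\varphi)^\perp:\equiv\forall x\varphi^\perp$. Rules (formulas may contain free variables): $T$ is closed under $\mathrm{DNE\text{ - }R}(\Gamma)$ if $T\vdash\neg\neg\varphi$ implies $T\vdash\varphi$ for $\varphi\in\Gamma$; under $\mathrm{CD\text{ - }R}(\Gamma)$ if $T\vdash\forall x(\varphi\lor\psi)$ implies $T\vdash\varphi\lor\forall x\psi$ for $\varphi,\psi\in\Gamma$ with $x$ not free in $\varphi$; under $\mathrm{DML\text{ - }R}(\Gamma)$ if $T\vdash\neg(\varphi\land\psi)$ implies $T\vdash\neg\varphi\lor\neg\psi$ for $\varphi,\psi\in\Gamma$; under $\mathrm{DMLD\text{ - }R}(\Gamma)$ if $T\vdash\neg(\varphi\land\psi)$ implies $T\vdash\varphi^\perp\lor\psi^\perp$ for $\varphi,\psi\in\Gamma$. Degree: an alternation path is a finite sequence of symbols $+,-$ in which they alternate; $i(s)$ is the first symbol of $s$ if nonempty and $\times$ if empty, $s^\perp$ swaps $+$ and $-$, $l(s)$ is the length. $\mathrm{Alt}(\varphi)=\{\langle\rangle\}$ for quantifier-free $\varphi$; otherwise $\mathrm{Alt}(\varphi_1\land\varphi_2)=\mathrm{Alt}(\varphi_1\lor\varphi_2)=\mathrm{Alt}(\varphi_1)\cup\mathrm{Alt}(\varphi_2)$,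 $\mathrm{Alt}(\varphi_1\to\varphi_2)=\{s^\perp:s\in\mathrm{Alt}(\varphi_1)\}\cup\mathrm{Alt}(\varphi_2)$, $\mathrm{Alt}(\forall x\varphi_1)=\{s\in\mathrm{Alt}(\varphi_1):i(s)=-\}\cup\{ -s:s\in\mathrm{Alt}(\varphi_1),i(s)\ne-\}$, $\mathrm{Alt}(\exists x\varphi_1)=\{s\in\mathrm{Alt}(\varphi_1):i(s)=+\}\cup\{+s:s\in\mathrm{Alt}(\varphi_1),i(s)\ne+\}$. $\deg(\varphi)=\max\{l(s):s\in\mathrm{Alt}(\varphi)\}$; $\mathrm{F}_k^+$ = formulas of degree $\le k$. $\mathcal{R}_0=\mathcal{J}_0=\Sigma_0$; $\mathcal{R}_{k+1},\mathcal{J}_{k+1}$ are simultaneously generated by: every formula of $\mathrm{F}_k^+$ is in both; for $R,R'\in\mathcal{R}_{k+1}$, $J,J'\in\mathcal{J}_{k+1}$: $R\land R',R\lor R',\forall xR,J\to R\in\mathcal{R}_{k+1}$ and $J\land J',J\lor J',\exists xJ,R\to J\in\mathcal{J}_{k+1}$. $\mathcal{Q}_0=\Sigma_0$; $\mathcal{Q}_{k+1}$ is generated by prime formulas and closure under $\land,\lor,\forall x,\exists x$, and $J\to Q$ for $J\in\mathcal{J}_{k+1}$, $Q\in\mathcal{Q}_{k+1}$. -}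

module Defs where

open import Data.Nat using (ℕ; zero; suc; _≤_; _⊔_)
open import Data.Fin using (Fin; toℕ)
open import Data.Vec using (Vec; []; _∷_)
open import Data.List using (List; []; _∷_; _++_; map; length)
open import Data.List.Membership.Propositional using (_∈_)
open import Data.Product using (_×_; _,_)
open import Data.Sum using (_⊎_)
open import Data.Unit using (⊤)
open import Data.Empty using (⊥)
open import Data.Nat using (_<_)

-- Codes of primitive recursive functions (one function symbol each)

data PR : ℕ → Set where
  Zf   : PR 0
  Sf   : PR 1
  Pf   : {n : ℕ} → Fin n → PR n
  Cf   : {m n : ℕ} → PR m → Vec (PR n) m → PR n
  Rf   : {n : ℕ} → PR n → PR (suc (suc n)) → PR (suc n)

data Term : Set where
  var : ℕ → Term
  app : {n : ℕ} → PR n → Vec Term n → Term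

infixr 6 _∧'_
infixr 5 _∨'_
infixr 4 _⇒'_
infix 7 _≐_

data Form : Set where
  _≐_  : Term → Term → Form
  ⊥'   : Form
  _∧'_ : Form → Form → Form
  _∨'_ : Form → Form → Form
  _⇒'_ : Form → Form → Form
  ∀'   : Form → Form     -- binds de Bruijn variable 0
  ∃'   : Form → Form

¬' : Form → Form
¬' φ = φ ⇒' ⊥'

Subst : Set
Subst = ℕ → Term

mutual
  substT : Subst → Term → Term
  substT σ (var i)    = σ i
  substT σ (app f ts) = app f (substV σ ts)

  substV : {n : ℕ} → Subst → Vec Term n → Vec Term n
  substV σ []       = []
  substV σ (t ∷ ts) = substT σ t ∷ substV σ ts

shiftT : Term → Term
shiftT = substT (λ i → var (suc i))

lift : Subst → Subst
lift σ zero    = var zero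
lift σ (suc i) = shiftT (σ i)

subst : Subst → Form → Form
subst σ (s ≐ t)  = substT σ s ≐ substT σ t
subst σ ⊥'       = ⊥'
subst σ (φ ∧' ψ) = subst σ φ ∧' subst σ ψ
subst σ (φ ∨' ψ) = subst σ φ ∨' subst σ ψ
subst σ (φ ⇒' ψ) = subst σ φ ⇒' subst σ ψ
subst σ (∀' φ)   = ∀' (subst (lift σ) φ)
subst σ (∃' φ)   = ∃' (subst (lift σ) φ)

shift : Form → Form
shift = subst (λ i → var (suc i))

sub0 : Subst → Term → Subst
sub0 _ t zero    = t
sub0 _ t (suc i) = var i

_[_] : Form → Term → Form
φ [ t ] = subst (sub0 var t) φ

mutual
  TermBelow : ℕ → Term → Set
  TermBelow n (var i)    = i < n
  TermBelow n (app f ts) = VecBelow n ts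

  VecBelow : {m : ℕ} → ℕ → Vec Term m → Set
  VecBelow n []       = ⊤
  VecBelow n (t ∷ ts) = TermBelow n t × VecBelow n ts

FormBelow : ℕ → Form → Set
FormBelow n (s ≐ t)  = TermBelow n s × TermBelow n t
FormBelow n ⊥'       = ⊤
FormBelow n (φ ∧' ψ) = FormBelow n φ × FormBelow n ψ
FormBelow n (φ ∨' ψ) = FormBelow n φ × FormBelow n ψ
FormBelow n (φ ⇒' ψ) = FormBelow n φ × FormBelow n ψ
FormBelow n (∀' φ)   = FormBelow (suc n) φ
FormBelow n (∃' φ)   = FormBelow (suc n) φ

Sentence : Form → Set
Sentence = FormBelow 0

-- Intuitionistic natural deduction (with equality) over a set of axioms.
-- Axioms may contain free variables (read as their universal closures).

Theory : Set₁
Theory = Form → Set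

infix 3 _⊢_⇒_
data _⊢_⇒_ (Ax : Theory) : List Form → Form → Set where
  hyp   : ∀ {Γ φ} → φ ∈ Γ → Ax ⊢ Γ ⇒ φ
  ax    : ∀ {Γ φ} → Ax φ → Ax ⊢ Γ ⇒ φ
  ⊥E    : ∀ {Γ φ} → Ax ⊢ Γ ⇒ ⊥' → Ax ⊢ Γ ⇒ φ
  ∧I    : ∀ {Γ φ ψ} → Ax ⊢ Γ ⇒ φ → Ax ⊢ Γ ⇒ ψ → Ax ⊢ Γ ⇒ φ ∧' ψ
  ∧E₁   : ∀ {Γ φ ψ} → Ax ⊢ Γ ⇒ φ ∧' ψ → Ax ⊢ Γ ⇒ φ
  ∧E₂   : ∀ {Γ φ ψ} → Ax ⊢ Γ ⇒ φ ∧' ψ → Ax ⊢ Γ ⇒ ψ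
  ∨I₁   : ∀ {Γ φ ψ} → Ax ⊢ Γ ⇒ φ → Ax ⊢ Γ ⇒ φ ∨' ψ
  ∨I₂   : ∀ {Γ φ ψ} → Ax ⊢ Γ ⇒ ψ → Ax ⊢ Γ ⇒ φ ∨' ψ
  ∨E    : ∀ {Γ φ ψ χ} → Ax ⊢ Γ ⇒ φ ∨' ψ → Ax ⊢ φ ∷ Γ ⇒ χ → Ax ⊢ ψ ∷ Γ ⇒ χ
          → Ax ⊢ Γ ⇒ χ
  ⇒I    : ∀ {Γ φ ψ} → Ax ⊢ φ ∷ Γ ⇒ ψ → Ax ⊢ Γ ⇒ φ ⇒' ψ
  ⇒E    : ∀ {Γ φ ψ} → Ax ⊢ Γ ⇒ φ ⇒' ψ → Ax ⊢ Γ ⇒ φ → Ax ⊢ Γ ⇒ ψ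
  ∀I    : ∀ {Γ φ} → Ax ⊢ map shift Γ ⇒ φ → Ax ⊢ Γ ⇒ ∀' φ
  ∀E    : ∀ {Γ φ} (t : Term) → Ax ⊢ Γ ⇒ ∀' φ → Ax ⊢ Γ ⇒ φ [ t ]
  ∃I    : ∀ {Γ φ} (t : Term) → Ax ⊢ Γ ⇒ φ [ t ] → Ax ⊢ Γ ⇒ ∃' φ
  ∃E    : ∀ {Γ φ χ} → Ax ⊢ Γ ⇒ ∃' φ → Ax ⊢ φ ∷ map shift Γ ⇒ shift χ
          → Ax ⊢ Γ ⇒ χ
  ≐refl : ∀ {Γ} (t : Term) → Ax ⊢ Γ ⇒ t ≐ t
  ≐subst : ∀ {Γ} (φ : Form) (s t : Term) → Ax ⊢ Γ ⇒ s ≐ t → Ax ⊢ Γ ⇒ φ [ s ]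
          → Ax ⊢ Γ ⇒ φ [ t ]

infix 3 _⊢_
_⊢_ : Theory → Form → Set
T ⊢ φ = T ⊢ [] ⇒ φ

zeroT : Term
zeroT = app Zf []

succT : Term → Term
succT t = app Sf (t ∷ [])

varsFrom : (o n : ℕ) → Vec Term n
varsFrom o zero    = []
varsFrom o (suc n) = var o ∷ varsFrom (suc o) n

appAll : {m n : ℕ} → Vec (PR n) m → Vec Term n → Vec Term m
appAll []       xs = []
appAll (g ∷ gs) xs = app g xs ∷ appAll gs xs

stepσ : Subst
stepσ zero    = succT (var zero)
stepσ (suc i) = var (suc i)

data HAax : Form → Set where
  succ≠0  : HAax (succT (var 0) ≐ zeroT ⇒' ⊥')
  succInj : HAax (succT (var 0) ≐ succT (var 1) ⇒' var 0 ≐ var 1)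
  projEq  : ∀ {n} (i : Fin n) → HAax (app (Pf i) (varsFrom 0 n) ≐ var (toℕ i))
  compEq  : ∀ {m n} (f : PR m) (gs : Vec (PR n) m) →
            HAax (app (Cf f gs) (varsFrom 0 n) ≐ app f (appAll gs (varsFrom 0 n)))
  recEq₀  : ∀ {n} (f : PR n) (g : PR (suc (suc n))) →
            HAax (app (Rf f g) (zeroT ∷ varsFrom 1 n) ≐ app f (varsFrom 1 n))
  recEqS  : ∀ {n} (f : PR n) (g : PR (suc (suc n))) →
            HAax (app (Rf f g) (succT (var 0) ∷ varsFrom 1 n)
                  ≐ app g (app (Rf f g) (var 0 ∷ varsFrom 1 n) ∷ var 0 ∷ varsFrom 1 n))
  ind     : ∀ (φ : Form) →
            HAax ((φ [ zeroT ] ∧' ∀' (φ ⇒' subst stepσ φ))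
                   ⇒' ∀' φ)

HA : Theory
HA = HAax

data PAax : Form → Set where
  haAx : ∀ {φ} → HAax φ → PAax φ
  lem  : ∀ (φ : Form) → PAax (φ ∨' ¬' φ)

PA : Theory
PA = PAax

_+ₜ_ : Theory → Theory → Theory
(T +ₜ X) φ = T φ ⊎ X φ

SemiClassical : Theory → Set
SemiClassical T = (∀ φ → HA ⊢ φ → T ⊢ φ) × (∀ φ → T ⊢ φ → PA ⊢ φ)

data QF : Form → Set where
  qf≐ : ∀ s t → QF (s ≐ t)
  qf⊥ : QF ⊥'
  qf∧ : ∀ {φ ψ} → QF φ → QF ψ → QF (φ ∧' ψ)
  qf∨ : ∀ {φ ψ} → QF φ → QF ψ → QF (φ ∨' ψ)
  qf⇒ : ∀ {φ ψ} → QF φ → QF ψ → QF (φ ⇒' ψ)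

data Prime : Form → Set where
  pr≐ : ∀ s t → Prime (s ≐ t)
  pr⊥ : Prime ⊥'

-- Σ_k and Π_k (blocks ∃x1⋯∃xn / ∀x1⋯∀xn with n ≥ 0)
mutual
  data Σₖ : ℕ → Form → Set where
    Σ0  : ∀ {φ} → QF φ → Σₖ 0 φ
    Σπ  : ∀ {k φ} → Πₖ k φ → Σₖ (suc k) φ
    Σ∃  : ∀ {k φ} → Σₖ (suc k) φ → Σₖ (suc k) (∃' φ)

  data Πₖ : ℕ → Form → Set where
    Π0  : ∀ {φ} → QF φ → Πₖ 0 φ
    Πσ  : ∀ {k φ} → Σₖ k φ → Πₖ (suc k) φ
    Π∀  : ∀ {k φ} → Πₖ (suc k) φ → Πₖ (suc k) (∀' φ)

data Π∨Π (k : ℕ) : Form → Set where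
  π∨π : ∀ {φ ψ} → Πₖ k φ → Πₖ k ψ → Π∨Π k (φ ∨' ψ)

-- dual of a prenex formula
dual : Form → Form
dual (∀' φ) = ∃' (dual φ)
dual (∃' φ) = ∀' (dual φ)
dual φ      = ¬' φ

data Sign : Set where
  ⊕ ⊖ : Sign

Path : Set
Path = List Sign

flipS : Sign → Sign
flipS ⊕ = ⊖
flipS ⊖ = ⊕

perp : Path → Path
perp = map flipS

addHead : Sign → Path → Path
addHead ⊖ (⊖ ∷ s) = ⊖ ∷ s
addHead ⊕ (⊕ ∷ s) = ⊕ ∷ s
addHead c s       = c ∷ s

-- Alt(φ), finite sets represented as lists
Alt : Form → List Path
Alt (s ≐ t)  = [] ∷ []
Alt ⊥'       = [] ∷ []
Alt (φ ∧' ψ) = Alt φ ++ Alt ψ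
Alt (φ ∨' ψ) = Alt φ ++ Alt ψ
Alt (φ ⇒' ψ) = map perp (Alt φ) ++ Alt ψ
Alt (∀' φ)   = map (addHead ⊖) (Alt φ)
Alt (∃' φ)   = map (addHead ⊕) (Alt φ)

maxLen : List Path → ℕ
maxLen []       = 0
maxLen (s ∷ ss) = length s ⊔ maxLen ss

deg : Form → ℕ
deg φ = maxLen (Alt φ)

F⁺ : ℕ → Form → Set
F⁺ k φ = deg φ ≤ k

mutual
  data 𝓡 : ℕ → Form → Set where
    R0   : ∀ {φ} → QF φ → 𝓡 0 φ
    Rdeg : ∀ {k φ} → F⁺ k φ → 𝓡 (suc k) φ
    R∧   : ∀ {k φ ψ} → 𝓡 (suc k) φ → 𝓡 (suc k) ψ → 𝓡 (suc k) (φ ∧' ψ)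
    R∨   : ∀ {k φ ψ} → 𝓡 (suc k) φ → 𝓡 (suc k) ψ → 𝓡 (suc k) (φ ∨' ψ)
    R∀   : ∀ {k φ} → 𝓡 (suc k) φ → 𝓡 (suc k) (∀' φ)
    R⇒   : ∀ {k φ ψ} → 𝓙 (suc k) φ → 𝓡 (suc k) ψ → 𝓡 (suc k) (φ ⇒' ψ)

  data 𝓙 : ℕ → Form → Set where
    J0   : ∀ {φ} → QF φ → 𝓙 0 φ
    Jdeg : ∀ {k φ} → F⁺ k φ → 𝓙 (suc k) φ
    J∧   : ∀ {k φ ψ} → 𝓙 (suc k) φ → 𝓙 (suc k) ψ → 𝓙 (suc k) (φ ∧' ψ)
    J∨   : ∀ {k φ ψ} → 𝓙 (suc k) φ → 𝓙 (suc k) ψ → 𝓙 (suc k) (φ ∨' ψ)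
    J∃   : ∀ {k φ} → 𝓙 (suc k) φ → 𝓙 (suc k) (∃' φ)
    J⇒   : ∀ {k φ ψ} → 𝓡 (suc k) φ → 𝓙 (suc k) ψ → 𝓙 (suc k) (φ ⇒' ψ)

data 𝓠 : ℕ → Form → Set where
  Q0   : ∀ {φ} → QF φ → 𝓠 0 φ
  Qpr  : ∀ {k φ} → Prime φ → 𝓠 (suc k) φ
  Q∧   : ∀ {k φ ψ} → 𝓠 (suc k) φ → 𝓠 (suc k) ψ → 𝓠 (suc k) (φ ∧' ψ)
  Q∨   : ∀ {k φ ψ} → 𝓠 (suc k) φ → 𝓠 (suc k) ψ → 𝓠 (suc k) (φ ∨' ψ)
  Q∀   : ∀ {k φ} → 𝓠 (suc k) φ → 𝓠 (suc k) (∀' φ)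
  Q∃   : ∀ {k φ} → 𝓠 (suc k) φ → 𝓠 (suc k) (∃' φ)
  Q⇒   : ∀ {k φ ψ} → 𝓙 (suc k) φ → 𝓠 (suc k) ψ → 𝓠 (suc k) (φ ⇒' ψ)

Conservative : (Γ : Form → Set) → Theory → Theory → Set
Conservative Γ T' T = ∀ φ → Γ φ → T' ⊢ φ → T ⊢ φ

DNE-R : (Form → Set) → Theory → Set
DNE-R Γ T = ∀ φ → Γ φ → T ⊢ ¬' (¬' φ) → T ⊢ φ

-- x not free in φ is expressed by writing φ weakened (shift φ) under the binder
CD-R : (Form → Set) → Theory → Set
CD-R Γ T = ∀ φ ψ → Γ φ → Γ ψ → T ⊢ ∀' (shift φ ∨' ψ) → T ⊢ φ ∨' ∀' ψ

DML-R : (Form → Set) → Theory → Set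
DML-R Γ T = ∀ φ ψ → Γ φ → Γ ψ → T ⊢ ¬' (φ ∧' ψ) → T ⊢ ¬' φ ∨' ¬' ψ

DMLD-R : (Form → Set) → Theory → Set
DMLD-R Γ T = ∀ φ ψ → Γ φ → Γ ψ → T ⊢ ¬' (φ ∧' ψ) → T ⊢ dual φ ∨' dual ψ

ProvesDNE : (Form → Set) → Theory → Set
ProvesDNE Γ T = ∀ φ → Γ φ → T ⊢ ¬' (¬' φ) ⇒' φ

{-# OPTIONS --safe #-}
module Submission where

-- The rules (2), (4) and (5) pass into one another by duality and PA proves φ ∨ φ^⊥, so
-- the content lies in deriving (1) from the rules.  Constant domain for Π_{k+1} yields
-- φ ∨ φ^⊥ for φ ∈ Σ_k by induction on the prefix: apply it to ∀x (∃x φ ∨ φ^⊥).  Under this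
-- principle a quantified formula of degree at most k has a prenex form in Σ_k or Π_k, so all
-- formulas of degree at most k are decided and agree with their Gödel–Gentzen translation N.
-- Hence R → N R for R ∈ 𝓡_{k+1}, N J → ¬¬J for J ∈ 𝓙_{k+1}, and Q → N Q for Q ∈ 𝓠_{k+1}, so
-- the translation maps proofs in PA + X to proofs in T + X; a theorem φ ∨ ψ with
-- φ, ψ ∈ Π_{k+1} becomes ¬¬(φ ∨ ψ), and rule (2) applies.

open import Defs
open import Data.Nat using (ℕ; zero; suc; _≤_; z≤n; s≤s; s≤s⁻¹; _≤′_; ≤′-refl; ≤′-step; _<_; _⊔_; _+_)
open import Data.Nat.Properties using (≤-trans; m≤m⊔n; m≤n⊔m; n≮0; ≤-refl; n≤1+n; m<1+n⇒m<n∨m≡n; +-suc; +-identityʳ; z≤′n; ≤′-trans)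
open import Data.Vec using (Vec; []; _∷_)
open import Data.List using (List; []; _∷_; map; length)
open import Data.List.Properties using (length-map)
open import Data.List.Membership.Propositional using (_∈_)
open import Data.List.Membership.Propositional.Properties using (∈-map⁺; ∈-++⁺ˡ; ∈-++⁺ʳ)
open import Data.List.Relation.Binary.Subset.Propositional using (_⊆_)
open import Data.List.Relation.Binary.Subset.Propositional.Properties using (∷⁺ʳ; map⁺)
open import Data.List.Relation.Unary.All as All using (All; []; _∷_)
import Data.List.Relation.Unary.All.Properties as Allₚ
open import Data.List.Relation.Unary.Any using (here; there)
open import Data.Product using (_×_; _,_; proj₁; proj₂; ∃-syntax)
open import Data.Sum using (inj₁; inj₂)
open import Data.Unit using (⊤; tt)
open import Data.Empty using (⊥-elim)
open import Function.Base using (_∘_)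
open import Function.Bundles using (_⇔_; mk⇔)
open import Relation.Nullary using (¬_)
open import Relation.Binary.PropositionalEquality as ≡ using (_≡_; refl; cong; cong₂)

-- Substitution

lift-cong : ∀ {σ τ} → (∀ i → σ i ≡ τ i) → ∀ i → lift σ i ≡ lift τ i
lift-cong e zero    = refl
lift-cong e (suc i) = cong shiftT (e i)

mutual
  substT-cong : ∀ {σ τ} → (∀ i → σ i ≡ τ i) → ∀ t → substT σ t ≡ substT τ t
  substT-cong e (var i)    = e i
  substT-cong e (app f ts) = cong (app f) (substV-cong e ts)

  substV-cong : ∀ {σ τ n} → (∀ i → σ i ≡ τ i) → (ts : Vec Term n) → substV σ ts ≡ substV τ ts
  substV-cong e []       = refl
  substV-cong e (t ∷ ts) = cong₂ _∷_ (substT-cong e t) (substV-cong e ts)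

mutual
  substT-var : ∀ t → substT var t ≡ t
  substT-var (var i)    = refl
  substT-var (app f ts) = cong (app f) (substV-var ts)

  substV-var : ∀ {n} (ts : Vec Term n) → substV var ts ≡ ts
  substV-var []       = refl
  substV-var (t ∷ ts) = cong₂ _∷_ (substT-var t) (substV-var ts)

mutual
  substT-∘ : ∀ σ τ t → substT σ (substT τ t) ≡ substT (substT σ ∘ τ) t
  substT-∘ σ τ (var i)    = refl
  substT-∘ σ τ (app f ts) = cong (app f) (substV-∘ σ τ ts)

  substV-∘ : ∀ {n} σ τ (ts : Vec Term n) → substV σ (substV τ ts) ≡ substV (substT σ ∘ τ) ts
  substV-∘ σ τ []       = refl
  substV-∘ σ τ (t ∷ ts) = cong₂ _∷_ (substT-∘ σ τ t) (substV-∘ σ τ ts)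

lift-∘ : ∀ σ τ i → substT (lift σ) (lift τ i) ≡ lift (substT σ ∘ τ) i
lift-∘ σ τ zero    = refl
lift-∘ σ τ (suc i) = ≡.trans (substT-∘ (lift σ) (var ∘ suc) (τ i))
                             (≡.sym (substT-∘ (var ∘ suc) σ (τ i)))

subst-cong : ∀ {σ τ} → (∀ i → σ i ≡ τ i) → ∀ φ → subst σ φ ≡ subst τ φ
subst-cong e (s ≐ t)  = cong₂ _≐_ (substT-cong e s) (substT-cong e t)
subst-cong e ⊥'       = refl
subst-cong e (φ ∧' ψ) = cong₂ _∧'_ (subst-cong e φ) (subst-cong e ψ)
subst-cong e (φ ∨' ψ) = cong₂ _∨'_ (subst-cong e φ) (subst-cong e ψ)
subst-cong e (φ ⇒' ψ) = cong₂ _⇒'_ (subst-cong e φ) (subst-cong e ψ)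
subst-cong e (∀' φ)   = cong ∀' (subst-cong (lift-cong e) φ)
subst-cong e (∃' φ)   = cong ∃' (subst-cong (lift-cong e) φ)

lift-var : ∀ {σ} → (∀ i → σ i ≡ var i) → ∀ i → lift σ i ≡ var i
lift-var e zero    = refl
lift-var e (suc i) = cong shiftT (e i)

subst-id : ∀ {σ} → (∀ i → σ i ≡ var i) → ∀ φ → subst σ φ ≡ φ
subst-id e (s ≐ t)  = cong₂ _≐_ (≡.trans (substT-cong e s) (substT-var s))
                                (≡.trans (substT-cong e t) (substT-var t))
subst-id e ⊥'       = refl
subst-id e (φ ∧' ψ) = cong₂ _∧'_ (subst-id e φ) (subst-id e ψ)
subst-id e (φ ∨' ψ) = cong₂ _∨'_ (subst-id e φ) (subst-id e ψ)
subst-id e (φ ⇒' ψ) = cong₂ _⇒'_ (subst-id e φ) (subst-id e ψ)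
subst-id e (∀' φ)   = cong ∀' (subst-id (lift-var e) φ)
subst-id e (∃' φ)   = cong ∃' (subst-id (lift-var e) φ)

subst-∘ : ∀ σ τ φ → subst σ (subst τ φ) ≡ subst (substT σ ∘ τ) φ
subst-∘ σ τ (s ≐ t)  = cong₂ _≐_ (substT-∘ σ τ s) (substT-∘ σ τ t)
subst-∘ σ τ ⊥'       = refl
subst-∘ σ τ (φ ∧' ψ) = cong₂ _∧'_ (subst-∘ σ τ φ) (subst-∘ σ τ ψ)
subst-∘ σ τ (φ ∨' ψ) = cong₂ _∨'_ (subst-∘ σ τ φ) (subst-∘ σ τ ψ)
subst-∘ σ τ (φ ⇒' ψ) = cong₂ _⇒'_ (subst-∘ σ τ φ) (subst-∘ σ τ ψ)
subst-∘ σ τ (∀' φ)   = cong ∀' (≡.trans (subst-∘ (lift σ) (lift τ) φ) (subst-cong (lift-∘ σ τ) φ))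
subst-∘ σ τ (∃' φ)   = cong ∃' (≡.trans (subst-∘ (lift σ) (lift τ) φ) (subst-cong (lift-∘ σ τ) φ))

substT-shiftT : ∀ s t → substT (sub0 var t) (shiftT s) ≡ s
substT-shiftT s t = ≡.trans (substT-∘ (sub0 var t) (var ∘ suc) s) (substT-var s)

-- Lets a quantified formula that was shifted under a new binder be instantiated at the variable of
-- that binder.
subst-lift-var0 : ∀ φ → (subst (lift (var ∘ suc)) φ) [ var 0 ] ≡ φ
subst-lift-var0 φ = ≡.trans (subst-∘ (sub0 var (var 0)) (lift (var ∘ suc)) φ) (subst-id var0 φ)
  where
  var0 : ∀ i → substT (sub0 var (var 0)) (lift (var ∘ suc) i) ≡ var i
  var0 zero    = refl
  var0 (suc i) = refl

-- Prenex classes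

QF-subst : ∀ {φ} σ → QF φ → QF (subst σ φ)
QF-subst σ (qf≐ s t) = qf≐ _ _
QF-subst σ qf⊥       = qf⊥
QF-subst σ (qf∧ p q) = qf∧ (QF-subst σ p) (QF-subst σ q)
QF-subst σ (qf∨ p q) = qf∨ (QF-subst σ p) (QF-subst σ q)
QF-subst σ (qf⇒ p q) = qf⇒ (QF-subst σ p) (QF-subst σ q)

mutual
  Σ-subst : ∀ {k φ} σ → Σₖ k φ → Σₖ k (subst σ φ)
  Σ-subst σ (Σ0 q) = Σ0 (QF-subst σ q)
  Σ-subst σ (Σπ p) = Σπ (Π-subst σ p)
  Σ-subst σ (Σ∃ p) = Σ∃ (Σ-subst (lift σ) p)

  Π-subst : ∀ {k φ} σ → Πₖ k φ → Πₖ k (subst σ φ)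
  Π-subst σ (Π0 q) = Π0 (QF-subst σ q)
  Π-subst σ (Πσ p) = Πσ (Σ-subst σ p)
  Π-subst σ (Π∀ p) = Π∀ (Π-subst (lift σ) p)

mutual
  -- The additional level is an empty block next to the quantifier-free core, so the blocks of the
  -- prefix keep their places.
  Σ-suc : ∀ {k φ} → Σₖ k φ → Σₖ (suc k) φ
  Σ-suc (Σ0 q) = Σπ (Π0 q)
  Σ-suc (Σπ p) = Σπ (Π-suc p)
  Σ-suc (Σ∃ p) = Σ∃ (Σ-suc p)

  Π-suc : ∀ {k φ} → Πₖ k φ → Πₖ (suc k) φ
  Π-suc (Π0 q) = Πσ (Σ0 q)
  Π-suc (Πσ p) = Πσ (Σ-suc p)
  Π-suc (Π∀ p) = Π∀ (Π-suc p)

Σ-mono : ∀ {j k φ} → j ≤′ k → Σₖ j φ → Σₖ k φ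
Σ-mono ≤′-refl     p = p
Σ-mono (≤′-step l) p = Σ-suc (Σ-mono l p)

Π-mono : ∀ {j k φ} → j ≤′ k → Πₖ j φ → Πₖ k φ
Π-mono ≤′-refl     p = p
Π-mono (≤′-step l) p = Π-suc (Π-mono l p)

dual-QF : ∀ {φ} → QF φ → dual φ ≡ ¬' φ
dual-QF (qf≐ s t) = refl
dual-QF qf⊥       = refl
dual-QF (qf∧ p q) = refl
dual-QF (qf∨ p q) = refl
dual-QF (qf⇒ p q) = refl

QF-dual : ∀ {φ} → QF φ → QF (dual φ)
QF-dual q = ≡.subst QF (≡.sym (dual-QF q)) (qf⇒ q qf⊥)

mutual
  Σ-dual : ∀ {k φ} → Σₖ k φ → Πₖ k (dual φ)
  Σ-dual (Σ0 q) = Π0 (QF-dual q)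
  Σ-dual (Σπ p) = Πσ (Π-dual p)
  Σ-dual (Σ∃ p) = Π∀ (Σ-dual p)

  Π-dual : ∀ {k φ} → Πₖ k φ → Σₖ k (dual φ)
  Π-dual (Π0 q) = Σ0 (QF-dual q)
  Π-dual (Πσ p) = Σπ (Σ-dual p)
  Π-dual (Π∀ p) = Σ∃ (Π-dual p)

≤′-pred : ∀ {j k} → suc j ≤′ k → j ≤′ k
≤′-pred = ≤′-trans (≤′-step ≤′-refl)

-- Derivations

weaken : ∀ {S Γ Δ φ} → Γ ⊆ Δ → S ⊢ Γ ⇒ φ → S ⊢ Δ ⇒ φ
weaken i (hyp x)          = hyp (i x)
weaken i (ax a)           = ax a
weaken i (⊥E d)           = ⊥E (weaken i d)
weaken i (∧I d e)         = ∧I (weaken i d) (weaken i e)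
weaken i (∧E₁ d)          = ∧E₁ (weaken i d)
weaken i (∧E₂ d)          = ∧E₂ (weaken i d)
weaken i (∨I₁ d)          = ∨I₁ (weaken i d)
weaken i (∨I₂ d)          = ∨I₂ (weaken i d)
weaken i (∨E d e f)       = ∨E (weaken i d) (weaken (∷⁺ʳ _ i) e) (weaken (∷⁺ʳ _ i) f)
weaken i (⇒I d)           = ⇒I (weaken (∷⁺ʳ _ i) d)
weaken i (⇒E d e)         = ⇒E (weaken i d) (weaken i e)
weaken i (∀I d)           = ∀I (weaken (map⁺ shift i) d)
weaken i (∀E t d)         = ∀E t (weaken i d)
weaken i (∃I t d)         = ∃I t (weaken i d)
weaken i (∃E d e)         = ∃E (weaken i d) (weaken (∷⁺ʳ _ (map⁺ shift i)) e)
weaken i (≐refl t)        = ≐refl t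
weaken i (≐subst φ s t d e) = ≐subst φ s t (weaken i d) (weaken i e)

-- Axioms are not shifted when a derivation passes under a binder, so a derivation without
-- hypotheses can replace an axiom anywhere.
interpret : ∀ {S S'} → (∀ φ → S φ → S' ⊢ φ) → ∀ {Γ φ} → S ⊢ Γ ⇒ φ → S' ⊢ Γ ⇒ φ
interpret f (hyp x)            = hyp x
interpret f (ax a)             = weaken (λ ()) (f _ a)
interpret f (⊥E d)             = ⊥E (interpret f d)
interpret f (∧I d e)           = ∧I (interpret f d) (interpret f e)
interpret f (∧E₁ d)            = ∧E₁ (interpret f d)
interpret f (∧E₂ d)            = ∧E₂ (interpret f d)
interpret f (∨I₁ d)            = ∨I₁ (interpret f d)
interpret f (∨I₂ d)            = ∨I₂ (interpret f d)
interpret f (∨E d e g)         = ∨E (interpret f d) (interpret f e) (interpret f g)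
interpret f (⇒I d)             = ⇒I (interpret f d)
interpret f (⇒E d e)           = ⇒E (interpret f d) (interpret f e)
interpret f (∀I d)             = ∀I (interpret f d)
interpret f (∀E t d)           = ∀E t (interpret f d)
interpret f (∃I t d)           = ∃I t (interpret f d)
interpret f (∃E d e)           = ∃E (interpret f d) (interpret f e)
interpret f (≐refl t)          = ≐refl t
interpret f (≐subst φ s t d e) = ≐subst φ s t (interpret f d) (interpret f e)

-- Theorems are closed under substitution because axioms may be generalised over any
-- number of variables.  Generalise over more variables than occur in φ, then instantiate.

AgreeBelow : ℕ → Subst → Subst → Set
AgreeBelow n σ τ = ∀ i → i < n → σ i ≡ τ i

agree-≤ : ∀ {m n σ τ} → m ≤ n → AgreeBelow n σ τ → AgreeBelow m σ τ
agree-≤ l a i i<m = a i (≤-trans i<m l)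

agree-lift : ∀ {n σ τ} → AgreeBelow n σ τ → AgreeBelow n (lift σ) (lift τ)
agree-lift a zero    l = refl
agree-lift a (suc i) l = cong shiftT (a i (≤-trans (n≤1+n _) l))

mutual
  substT-support : ∀ t → ∃[ n ] (∀ {σ τ} → AgreeBelow n σ τ → substT σ t ≡ substT τ t)
  substT-support (var i)    = suc i , λ a → a i ≤-refl
  substT-support (app f ts) with substV-support ts
  ... | n , e = n , λ a → cong (app f) (e a)

  substV-support : ∀ {m} (ts : Vec Term m) →
                   ∃[ n ] (∀ {σ τ} → AgreeBelow n σ τ → substV σ ts ≡ substV τ ts)
  substV-support []       = 0 , λ _ → refl
  substV-support (t ∷ ts) with substT-support t | substV-support ts
  ... | m , d | n , e = m ⊔ n , λ a →
    cong₂ _∷_ (d (agree-≤ (m≤m⊔n m n) a)) (e (agree-≤ (m≤n⊔m m n) a))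

subst-support : ∀ φ → ∃[ n ] (∀ {σ τ} → AgreeBelow n σ τ → subst σ φ ≡ subst τ φ)
subst-support (s ≐ t) with substT-support s | substT-support t
... | m , d | n , e = m ⊔ n , λ a →
  cong₂ _≐_ (d (agree-≤ (m≤m⊔n m n) a)) (e (agree-≤ (m≤n⊔m m n) a))
subst-support ⊥' = 0 , λ _ → refl
subst-support (φ ∧' ψ) with subst-support φ | subst-support ψ
... | m , d | n , e = m ⊔ n , λ a →
  cong₂ _∧'_ (d (agree-≤ (m≤m⊔n m n) a)) (e (agree-≤ (m≤n⊔m m n) a))
subst-support (φ ∨' ψ) with subst-support φ | subst-support ψ
... | m , d | n , e = m ⊔ n , λ a →
  cong₂ _∨'_ (d (agree-≤ (m≤m⊔n m n) a)) (e (agree-≤ (m≤n⊔m m n) a))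
subst-support (φ ⇒' ψ) with subst-support φ | subst-support ψ
... | m , d | n , e = m ⊔ n , λ a →
  cong₂ _⇒'_ (d (agree-≤ (m≤m⊔n m n) a)) (e (agree-≤ (m≤n⊔m m n) a))
subst-support (∀' φ) with subst-support φ
-- The bound for the body is kept although the binder would allow one less; any upper bound will do.
... | n , e = n , λ a → cong ∀' (e (agree-lift a))
subst-support (∃' φ) with subst-support φ
... | n , e = n , λ a → cong ∃' (e (agree-lift a))

infixr 5 _▹_
_▹_ : Term → Subst → Subst
(t ▹ τ) zero    = t
(t ▹ τ) (suc i) = τ i

-- The sequence σ 0, ..., σ (n-1) followed by τ. It grows from the right because the outermost of n
-- quantifiers binds variable n-1 of the matrix and is instantiated first.
splice : ℕ → Subst → Subst → Subst
splice zero    σ τ = τ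
splice (suc n) σ τ = splice n σ (σ n ▹ τ)

splice-≥ : ∀ n σ τ i → splice n σ τ (n + i) ≡ τ i
splice-≥ zero    σ τ i = refl
splice-≥ (suc n) σ τ i =
  ≡.trans (cong (splice n σ (σ n ▹ τ)) (≡.sym (+-suc n i))) (splice-≥ n σ (σ n ▹ τ) (suc i))

splice-< : ∀ n σ τ → AgreeBelow n (splice n σ τ) σ
splice-< (suc n) σ τ i l with m<1+n⇒m<n∨m≡n l
... | inj₁ i<n  = splice-< n σ (σ n ▹ τ) i i<n
... | inj₂ refl = ≡.trans (cong (splice n σ (σ n ▹ τ)) (≡.sym (+-identityʳ n)))
                          (splice-≥ n σ (σ n ▹ τ) 0)

∀ⁿ : ℕ → Form → Form
∀ⁿ zero    φ = φ
∀ⁿ (suc n) φ = ∀' (∀ⁿ n φ)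

∀ⁿ-intro : ∀ {S φ} n → S ⊢ φ → S ⊢ ∀ⁿ n φ
∀ⁿ-intro zero    d = d
∀ⁿ-intro (suc n) d = ∀I (∀ⁿ-intro n d)

∀ⁿ-elim : ∀ {S φ} n σ τ → S ⊢ subst τ (∀ⁿ n φ) → S ⊢ subst (splice n σ τ) φ
∀ⁿ-elim zero    σ τ d = d
∀ⁿ-elim {S} {φ} (suc n) σ τ d =
  ∀ⁿ-elim n σ (σ n ▹ τ) (≡.subst (S ⊢_) (≡.trans (subst-∘ _ _ (∀ⁿ n φ)) (subst-cong ▹-lift (∀ⁿ n φ)))
                                 (∀E (σ n) d))
  where
  ▹-lift : ∀ i → substT (sub0 var (σ n)) (lift τ i) ≡ (σ n ▹ τ) i
  ▹-lift zero    = refl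
  ▹-lift (suc i) = substT-shiftT (τ i) (σ n)

⊢-subst : ∀ {S φ} σ → S ⊢ φ → S ⊢ subst σ φ
⊢-subst {S} {φ} σ d with subst-support φ
... | n , e = ≡.subst (S ⊢_) (e (splice-< n σ var))
  (∀ⁿ-elim n σ var (≡.subst (S ⊢_) (≡.sym (subst-id (λ _ → refl) (∀ⁿ n φ))) (∀ⁿ-intro n d)))

-- Intuitionistic reasoning in an arbitrary theory

module Derived (S : Theory) where

  private variable
    Γ : List Form
    φ φ' ψ ψ' χ : Form

  h0 : S ⊢ φ ∷ Γ ⇒ φ
  h0 = hyp (here refl)

  h1 : S ⊢ ψ ∷ φ ∷ Γ ⇒ φ
  h1 = hyp (there (here refl))

  h2 : S ⊢ χ ∷ ψ ∷ φ ∷ Γ ⇒ φ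
  h2 = hyp (there (there (here refl)))

  h3 : S ⊢ χ ∷ φ' ∷ ψ ∷ φ ∷ Γ ⇒ φ
  h3 = hyp (there (there (there (here refl))))

  wk : S ⊢ φ → S ⊢ Γ ⇒ φ
  wk = weaken (λ ())

  wk1 : S ⊢ Γ ⇒ φ → S ⊢ ψ ∷ Γ ⇒ φ
  wk1 = weaken there

  conv : φ ≡ ψ → S ⊢ Γ ⇒ φ → S ⊢ Γ ⇒ ψ
  conv = ≡.subst (S ⊢ _ ⇒_)

  mp : S ⊢ φ ⇒' ψ → S ⊢ Γ ⇒ φ → S ⊢ Γ ⇒ ψ
  mp d = ⇒E (wk d)

  ⇒-refl : S ⊢ φ ⇒' φ
  ⇒-refl = ⇒I h0

  ⇒-trans : S ⊢ φ ⇒' ψ → S ⊢ ψ ⇒' χ → S ⊢ φ ⇒' χ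
  ⇒-trans d e = ⇒I (mp e (mp d h0))

  ∀E-var0 : S ⊢ Γ ⇒ shift (∀' φ) → S ⊢ Γ ⇒ φ
  ∀E-var0 {φ = φ} d = conv (subst-lift-var0 φ) (∀E (var 0) d)

  ∃I-var0 : S ⊢ Γ ⇒ φ → S ⊢ Γ ⇒ shift (∃' φ)
  ∃I-var0 {φ = φ} d = ∃I (var 0) (conv (≡.sym (subst-lift-var0 φ)) d)

  ∀-mono : S ⊢ φ ⇒' ψ → S ⊢ ∀' φ ⇒' ∀' ψ
  ∀-mono d = ⇒I (∀I (mp d (∀E-var0 h0)))

  ∃-mono : S ⊢ φ ⇒' ψ → S ⊢ ∃' φ ⇒' ∃' ψ
  ∃-mono d = ⇒I (∃E h0 (∃I-var0 (mp d h0)))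

  ∨-mono : S ⊢ φ ⇒' φ' → S ⊢ ψ ⇒' ψ' → S ⊢ φ ∨' ψ ⇒' φ' ∨' ψ'
  ∨-mono d e = ⇒I (∨E h0 (∨I₁ (mp d h0)) (∨I₂ (mp e h0)))

  contra : S ⊢ φ ⇒' ψ → S ⊢ ¬' ψ ⇒' ¬' φ
  contra d = ⇒I (⇒I (⇒E h1 (mp d h0)))

  ¬¬-mono : S ⊢ φ ⇒' ψ → S ⊢ ¬' (¬' φ) ⇒' ¬' (¬' ψ)
  ¬¬-mono = contra ∘ contra

  ¬¬I : S ⊢ φ ⇒' ¬' (¬' φ)
  ¬¬I = ⇒I (⇒I (⇒E h0 h1))

  ¬∃⇒∀¬ : S ⊢ ¬' (∃' φ) ⇒' ∀' (¬' φ)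
  ¬∃⇒∀¬ = ⇒I (∀I (⇒I (⇒E h1 (∃I-var0 h0))))

  ∀¬⇒¬∃ : S ⊢ ∀' (¬' φ) ⇒' ¬' (∃' φ)
  ∀¬⇒¬∃ = ⇒I (⇒I (∃E h0 (⇒E (∀E-var0 h2) h0)))

  ∃¬⇒¬∀ : S ⊢ ∃' (¬' φ) ⇒' ¬' (∀' φ)
  ∃¬⇒¬∀ = ⇒I (⇒I (∃E h1 (⇒E h0 (∀E-var0 h1))))

  ¬¬∀⇒∀¬¬ : S ⊢ ¬' (¬' (∀' φ)) ⇒' ∀' (¬' (¬' φ))
  ¬¬∀⇒∀¬¬ = ⇒I (∀I (⇒I (⇒E h1 (⇒I (⇒E h1 (∀E-var0 h0))))))

  Stable Decided : Form → Set
  Stable φ = S ⊢ ¬' (¬' φ) ⇒' φ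
  Decided φ = S ⊢ φ ∨' ¬' φ

  raa : Stable φ → S ⊢ ¬' φ ∷ Γ ⇒ ⊥' → S ⊢ Γ ⇒ φ
  raa s d = mp s (⇒I d)

  decided-stable : Decided φ → Stable φ
  decided-stable d = ⇒I (∨E (wk d) h0 (⊥E (⇒E h1 h0)))

  stable-∧ : Stable φ → Stable ψ → Stable (φ ∧' ψ)
  stable-∧ s t = ⇒I (∧I (mp s (mp (¬¬-mono (⇒I (∧E₁ h0))) h0))
                        (mp t (mp (¬¬-mono (⇒I (∧E₂ h0))) h0)))

  stable-⇒ : Stable ψ → Stable (φ ⇒' ψ)
  stable-⇒ s = ⇒I (⇒I (raa s (⇒E h2 (⇒I (⇒E h1 (⇒E h0 h2))))))

  stable-¬ : Stable (¬' φ)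
  stable-¬ = stable-⇒ (⇒I (⇒E h0 (⇒I h0)))

  stable-∀ : Stable φ → Stable (∀' φ)
  stable-∀ s = ⇒-trans ¬¬∀⇒∀¬¬ (∀-mono s)

  decided-⊥ : Decided ⊥'
  decided-⊥ = ∨I₂ ⇒-refl

  decided-∧ : Decided φ → Decided ψ → Decided (φ ∧' ψ)
  decided-∧ d e = ∨E d (∨E (wk e) (∨I₁ (∧I h1 h0)) (∨I₂ (⇒I (⇒E h1 (∧E₂ h0)))))
                       (∨I₂ (⇒I (⇒E h1 (∧E₁ h0))))

  decided-∨ : Decided φ → Decided ψ → Decided (φ ∨' ψ)
  decided-∨ d e = ∨E d (∨I₁ (∨I₁ h0))
                       (∨E (wk e) (∨I₁ (∨I₂ h0)) (∨I₂ (⇒I (∨E h0 (⇒E h3 h0) (⇒E h2 h0)))))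

  decided-⇒ : Decided φ → Decided ψ → Decided (φ ⇒' ψ)
  decided-⇒ d e = ∨E d (∨E (wk e) (∨I₁ (⇒I h1)) (∨I₂ (⇒I (⇒E h1 (⇒E h0 h2)))))
                       (∨I₁ (⇒I (⊥E (⇒E h1 h0))))

  -- A stable goal may be proved by contradiction, and then the double negation on the disjunction
  -- is harmless. This interprets classical case analysis.
  ¬¬∨E : Stable χ → S ⊢ Γ ⇒ ¬' (¬' (φ ∨' ψ)) → S ⊢ φ ∷ Γ ⇒ χ → S ⊢ ψ ∷ Γ ⇒ χ → S ⊢ Γ ⇒ χ
  ¬¬∨E s d e f = raa s (⇒E (wk1 d) (⇒I (∨E h0
    (⇒E h2 (⇒E (wk1 (wk1 (wk1 (⇒I e)))) h0)) (⇒E h2 (⇒E (wk1 (wk1 (wk1 (⇒I f)))) h0)))))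

  ¬¬∃E : Stable χ → S ⊢ Γ ⇒ ¬' (¬' (∃' φ)) → S ⊢ φ ∷ map shift Γ ⇒ shift χ → S ⊢ Γ ⇒ χ
  ¬¬∃E s d e = raa s (⇒E (wk1 d) (⇒I (∃E h0 (⇒E h2 (⇒E (wk1 (wk1 (wk1 (⇒I e)))) h0)))))

  infix 3 _⟺_
  _⟺_ : Form → Form → Set
  φ ⟺ ψ = S ⊢ φ ⇒' ψ × S ⊢ ψ ⇒' φ

  ⟺-refl : φ ⟺ φ
  ⟺-refl = ⇒-refl , ⇒-refl

  ⟺-trans : φ ⟺ ψ → ψ ⟺ χ → φ ⟺ χ
  ⟺-trans (d , e) (d' , e') = ⇒-trans d d' , ⇒-trans e' e

  ∀-cong : φ ⟺ ψ → ∀' φ ⟺ ∀' ψ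
  ∀-cong (d , e) = ∀-mono d , ∀-mono e

  ∃-cong : φ ⟺ ψ → ∃' φ ⟺ ∃' ψ
  ∃-cong (d , e) = ∃-mono d , ∃-mono e

  ∨-cong : φ ⟺ φ' → ψ ⟺ ψ' → φ ∨' ψ ⟺ φ' ∨' ψ'
  ∨-cong (d , e) (d' , e') = ∨-mono d d' , ∨-mono e e'

  ∧-cong : φ ⟺ φ' → ψ ⟺ ψ' → φ ∧' ψ ⟺ φ' ∧' ψ'
  ∧-cong (d , e) (d' , e') = ⇒I (∧I (mp d (∧E₁ h0)) (mp d' (∧E₂ h0)))
                           , ⇒I (∧I (mp e (∧E₁ h0)) (mp e' (∧E₂ h0)))

  ⇒-cong : φ ⟺ φ' → ψ ⟺ ψ' → φ ⇒' ψ ⟺ φ' ⇒' ψ'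
  ⇒-cong (d , e) (d' , e') = ⇒I (⇒I (mp d' (⇒E h1 (mp e h0)))) , ⇒I (⇒I (mp e' (⇒E h1 (mp d h0))))

  ∨-comm : φ ∨' ψ ⟺ ψ ∨' φ
  ∨-comm = swap , swap
    where
    swap : S ⊢ φ ∨' ψ ⇒' ψ ∨' φ
    swap = ⇒I (∨E h0 (∨I₂ h0) (∨I₁ h0))

  decided-cong : φ ⟺ ψ → Decided φ → Decided ψ
  decided-cong (d , e) = ⇒E (∨-mono d (contra e))

  -- The left-to-right direction is the constant domain principle, intuitionistically invalid in
  -- general; it is obtained by deciding `ψ` first.
  ∀-∨ˡ : Decided ψ → ∀' (φ ∨' shift ψ) ⟺ ∀' φ ∨' ψ
  ∀-∨ˡ d = ⇒I (∨E (wk d) (∨I₂ h0)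
                   (∨I₁ (∀I (∨E (∀E-var0 h1) h0 (⊥E (⇒E h1 h0))))))
         , ⇒I (∨E h0 (∀I (∨I₁ (∀E-var0 h0))) (∀I (∨I₂ h0)))

  ∃-∨ˡ : ∃' (φ ∨' shift ψ) ⟺ ∃' φ ∨' ψ
  ∃-∨ˡ = ⇒I (∃E h0 (∨E h0 (∨I₁ (∃I-var0 h0)) (∨I₂ h0)))
       , ⇒I (∨E h0 (∃E h0 (∃I-var0 (∨I₁ h0)))
                   -- The bound variable does not occur in `shift ψ`, so any term may serve as the
                   -- witness.
                   (∃I zeroT (∨I₂ (conv (≡.sym shift-zero) h0))))
    where
    shift-zero : ∀ {ψ} → (shift ψ) [ zeroT ] ≡ ψ
    shift-zero {ψ} = ≡.trans (subst-∘ (sub0 var zeroT) (var ∘ suc) ψ) (subst-id (λ _ → refl) ψ)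

  -- Past the quantifier prefix `dual` is plain negation, and each prefix step uses ∃¬ → ¬∀ or ∀¬ →
  -- ¬∃, both intuitionistic.
  dual⇒¬ : ∀ φ → S ⊢ dual φ ⇒' ¬' φ
  dual⇒¬ (s ≐ t)  = ⇒-refl
  dual⇒¬ ⊥'       = ⇒-refl
  dual⇒¬ (φ ∧' ψ) = ⇒-refl
  dual⇒¬ (φ ∨' ψ) = ⇒-refl
  dual⇒¬ (φ ⇒' ψ) = ⇒-refl
  dual⇒¬ (∀' φ)   = ⇒-trans (∃-mono (dual⇒¬ φ)) ∃¬⇒¬∀
  dual⇒¬ (∃' φ)   = ⇒-trans (∀-mono (dual⇒¬ φ)) ∀¬⇒¬∃

  dual-decided : S ⊢ φ ∨' dual φ → Decided φ
  dual-decided {φ} = ⇒E (∨-mono ⇒-refl (dual⇒¬ φ))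

  ProvesDNE-pred : ∀ {k} → ProvesDNE (Σₖ (suc k)) S → ProvesDNE (Σₖ k) S
  ProvesDNE-pred dne φ p = dne φ (Σ-suc p)

  -- Stability passes through universal quantifiers, so double negation elimination for Σ_k also
  -- covers a universal block in front.
  stable-Π : ∀ {k} → ProvesDNE (Σₖ k) S → Πₖ (suc k) φ → Stable φ
  stable-Π dne (Πσ p) = dne _ p
  stable-Π dne (Π∀ p) = stable-∀ (stable-Π dne p)

  mutual
    -- The leading existential block is free, since ¬∃ gives ∀¬. Double negation elimination is
    -- first used at the universal block behind it, hence one level lower.
    ¬⇒dual-Σ : ∀ k {φ} → ProvesDNE (Σₖ k) S → Σₖ (suc k) φ → S ⊢ ¬' φ ⇒' dual φ
    ¬⇒dual-Σ k dne (Σπ p) = ¬⇒dual-Π k dne p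
    ¬⇒dual-Σ k dne (Σ∃ p) = ⇒-trans ¬∃⇒∀¬ (∀-mono (¬⇒dual-Σ k dne p))

    ¬⇒dual-Π : ∀ k {φ} → ProvesDNE (Σₖ k) S → Πₖ k φ → S ⊢ ¬' φ ⇒' dual φ
    ¬⇒dual-Π zero {φ} dne (Π0 q) = conv (cong (¬' φ ⇒'_) (≡.sym (dual-QF q))) ⇒-refl
    ¬⇒dual-Π (suc k) dne (Πσ p) = ¬⇒dual-Σ k (ProvesDNE-pred dne) (Σ-suc p)
    ¬⇒dual-Π (suc k) dne (Π∀ p) =
      -- If no instance of the dual holds, every instance of the body holds doubly negated, hence
      -- holds by `stable-Π`, against the assumption.
      ⇒I (raa (dne _ (Σ∃ (Π-dual p)))
        (⇒E h1 (mp (∀-mono (⇒-trans (contra (¬⇒dual-Π (suc k) dne p))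
                                    (stable-Π (ProvesDNE-pred dne) p)))
                   (mp ¬∃⇒∀¬ h0))))

  dual-dual-QF : (∀ {φ} → QF φ → Decided φ) → QF φ → S ⊢ dual (dual φ) ⇒' φ
  dual-dual-QF {φ} dec q =
    conv (cong (λ χ → dual χ ⇒' φ) (≡.sym (dual-QF q))) (decided-stable (dec q))

  mutual
    -- Dualising twice restores the prefix and leaves a double negation only on the quantifier-free
    -- core.
    dual-dual-Σ : ∀ {k} → (∀ {φ} → QF φ → Decided φ) → Σₖ k φ → S ⊢ dual (dual φ) ⇒' φ
    dual-dual-Σ dec (Σ0 q) = dual-dual-QF dec q
    dual-dual-Σ dec (Σπ p) = dual-dual-Π dec p
    dual-dual-Σ dec (Σ∃ p) = ∃-mono (dual-dual-Σ dec p)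

    dual-dual-Π : ∀ {k} → (∀ {φ} → QF φ → Decided φ) → Πₖ k φ → S ⊢ dual (dual φ) ⇒' φ
    dual-dual-Π dec (Π0 q) = dual-dual-QF dec q
    dual-dual-Π dec (Πσ p) = dual-dual-Σ dec p
    dual-dual-Π dec (Π∀ p) = ∀-mono (dual-dual-Π dec p)

  -- Complements satisfy the De Morgan laws intuitionistically and are unique up to equivalence, so
  -- prenexing a conjunction reduces to prenexing a disjunction of duals.
  Complement : Form → Form → Set
  Complement φ ψ = S ⊢ φ ∨' ψ × S ⊢ ¬' (φ ∧' ψ)

  complement-sym : Complement φ ψ → Complement ψ φ
  complement-sym (d , e) = ⇒E (proj₁ ∨-comm) d , ⇒I (mp e (∧I (∧E₂ h0) (∧E₁ h0)))

  complement-dual : S ⊢ φ ∨' dual φ → Complement φ (dual φ)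
  complement-dual {φ} d = d , ⇒I (⇒E (mp (dual⇒¬ φ) (∧E₂ h0)) (∧E₁ h0))

  complement-∧ : Complement φ φ' → Complement ψ ψ' → Complement (φ ∧' ψ) (φ' ∨' ψ')
  complement-∧ (d , e) (d' , e') =
      ∨E d (∨E (wk d') (∨I₁ (∧I h1 h0)) (∨I₂ (∨I₂ h0))) (∨I₂ (∨I₁ h0))
    , ⇒I (∨E (∧E₂ h0) (mp e (∧I (∧E₁ (∧E₁ h1)) h0)) (mp e' (∧I (∧E₂ (∧E₁ h1)) h0)))

  complement-unique : Complement φ φ' → Complement ψ ψ' → φ' ⟺ ψ' → φ ⟺ ψ
  complement-unique c c' (d , e) = half c c' e , half c' c d
    where
    half : Complement φ φ' → Complement ψ ψ' → S ⊢ ψ' ⇒' φ' → S ⊢ φ ⇒' ψ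
    half (_ , a) (b , _) e = ⇒I (∨E (wk b) h0 (⊥E (mp a (∧I h1 (mp e h0)))))

  complement-⇒ : Complement φ φ' → φ' ∨' ψ ⟺ φ ⇒' ψ
  complement-⇒ (d , e) = ⇒I (⇒I (∨E h1 (⊥E (mp e (∧I h1 h0))) h0))
                       , ⇒I (∨E (wk d) (∨I₂ (⇒E h1 h0)) (∨I₁ h0))

  DNE-R⇒CD-R : ∀ {k} → DNE-R (Π∨Π (suc k)) S → CD-R (Πₖ (suc k)) S
  -- If φ ∨ ∀xψ is refuted, so is φ, and the premise then gives ψ for every x. The conclusion thus
  -- holds doubly negated and lies in the class of the rule.
  DNE-R⇒CD-R dne φ ψ p q d = dne _ (π∨π p (Π∀ q)) (⇒I (⇒E h0 (∨I₂ (∀I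
    (∨E (∀E-var0 (wk1 (⊢-subst _ d))) (⊥E (⇒E h1 (∨I₁ h0))) h0)))))

-- Decidability of quantifier-free formulas

-- Induction on the left variable, then on the right. Two successors are compared by the outer
-- induction hypothesis, through congruence in one case and injectivity in the other.
eq-decided : HA ⊢ ∀' (∀' (var 1 ≐ var 0 ∨' ¬' (var 1 ≐ var 0)))
eq-decided = ⇒E (ax (ind _)) (∧I
  (⇒E (ax (ind (zeroT ≐ var 0 ∨' ¬' (zeroT ≐ var 0)))) (∧I
    (∨I₁ (≐refl zeroT))
    (∀I (⇒I (∨I₂ (⇒I (⇒E (ax succ≠0) (≐subst (var 0 ≐ zeroT) _ _ h0 (≐refl zeroT)))))))))
  (∀I (⇒I (⇒E (ax (ind (succT (var 1) ≐ var 0 ∨' ¬' (succT (var 1) ≐ var 0)))) (∧I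
    (∨I₂ (ax succ≠0))
    (∀I (⇒I (∨E (∀E (var 0) h1)
      (∨I₁ (≐subst (succT (var 2) ≐ succT (var 0)) (var 1) (var 0) h0 (≐refl _)))
      (∨I₂ (⇒I (⇒E h1 (⇒E succ-inj h0))))))))))))
  where
  open Derived HA
  succ-inj : ∀ {Γ} → HA ⊢ Γ ⇒ succT (var 1) ≐ succT (var 0) ⇒' var 1 ≐ var 0
  -- Generalising and instantiating again exchanges the two variables of the axiom.
  succ-inj = ∀E (var 1) (∀E (var 0) (∀I (∀I (ax succInj))))

-- Alternation paths

length≤ : ∀ k ss → maxLen ss ≤ k → All (λ s → length s ≤ k) ss
length≤ k []       l = []
length≤ k (s ∷ ss) l = ≤-trans (m≤m⊔n (length s) (maxLen ss)) l
                     ∷ length≤ k ss (≤-trans (m≤n⊔m (length s) (maxLen ss)) l)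

-- All (U j) (Alt φ) and All (E j) (Alt φ) say that φ has degree at most j and that
-- the paths of length exactly j begin with ⊖, respectively ⊕.
U E : ℕ → Path → Set
U j []      = ⊤
U j (⊖ ∷ s) = suc (length s) ≤ j
U j (⊕ ∷ s) = suc (suc (length s)) ≤ j
E j []      = ⊤
E j (⊕ ∷ s) = suc (length s) ≤ j
E j (⊖ ∷ s) = suc (suc (length s)) ≤ j

E-perp : ∀ j s → E j (perp s) → U j s
E-perp j []      l = tt
E-perp j (⊖ ∷ s) l = ≡.subst (λ n → suc n ≤ j) (length-map flipS s) l
E-perp j (⊕ ∷ s) l = ≡.subst (λ n → suc (suc n) ≤ j) (length-map flipS s) l

U-perp : ∀ j s → U j (perp s) → E j s
U-perp j []      l = tt
U-perp j (⊕ ∷ s) l = ≡.subst (λ n → suc n ≤ j) (length-map flipS s) l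
U-perp j (⊖ ∷ s) l = ≡.subst (λ n → suc (suc n) ≤ j) (length-map flipS s) l

-- A path that stays within length j after ⊖ is put in front either began with ⊖ already or was
-- shorter than j. So the degree of ∀xφ controls the shape of φ.
U-addHead⊖ : ∀ j s → length (addHead ⊖ s) ≤ j → U j s
U-addHead⊖ j []      l = tt
U-addHead⊖ j (⊖ ∷ s) l = l
U-addHead⊖ j (⊕ ∷ s) l = l

E-addHead⊕ : ∀ j s → length (addHead ⊕ s) ≤ j → E j s
E-addHead⊕ j []      l = tt
E-addHead⊕ j (⊕ ∷ s) l = l
E-addHead⊕ j (⊖ ∷ s) l = l

U⇒length-⊖ : ∀ j s → U j (addHead ⊖ s) → length (addHead ⊖ s) ≤ j
U⇒length-⊖ j []      l = l
U⇒length-⊖ j (⊖ ∷ s) l = l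
U⇒length-⊖ j (⊕ ∷ s) l = l

E⇒length-⊕ : ∀ j s → E j (addHead ⊕ s) → length (addHead ⊕ s) ≤ j
E⇒length-⊕ j []      l = l
E⇒length-⊕ j (⊕ ∷ s) l = l
E⇒length-⊕ j (⊖ ∷ s) l = l

-- A path beginning with ⊖ is strictly shorter than j here, so a universal formula on the
-- existential side drops by one level.
E⇒length-⊖ : ∀ j s → E j (addHead ⊖ s) → suc (length (addHead ⊖ s)) ≤ j
E⇒length-⊖ j []      l = l
E⇒length-⊖ j (⊖ ∷ s) l = l
E⇒length-⊖ j (⊕ ∷ s) l = l

U⇒length-⊕ : ∀ j s → U j (addHead ⊕ s) → suc (length (addHead ⊕ s)) ≤ j
U⇒length-⊕ j []      l = l
U⇒length-⊕ j (⊕ ∷ s) l = l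
U⇒length-⊕ j (⊖ ∷ s) l = l

0<length-addHead : ∀ c s → 1 ≤ length (addHead c s)
0<length-addHead ⊖ []      = s≤s z≤n
0<length-addHead ⊖ (⊖ ∷ s) = s≤s z≤n
0<length-addHead ⊖ (⊕ ∷ s) = s≤s z≤n
0<length-addHead ⊕ []      = s≤s z≤n
0<length-addHead ⊕ (⊖ ∷ s) = s≤s z≤n
0<length-addHead ⊕ (⊕ ∷ s) = s≤s z≤n

length≤addHead : ∀ c s → length s ≤ length (addHead c s)
length≤addHead ⊖ []      = z≤n
length≤addHead ⊖ (⊖ ∷ s) = ≤-refl
length≤addHead ⊖ (⊕ ∷ s) = n≤1+n _
length≤addHead ⊕ []      = z≤n
length≤addHead ⊕ (⊖ ∷ s) = n≤1+n _
length≤addHead ⊕ (⊕ ∷ s) = ≤-refl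

-- Keeps bounds on all paths from holding vacuously, so that no quantified formula has degree zero.
Alt-nonempty : ∀ φ → ∃[ s ] s ∈ Alt φ
Alt-nonempty (s ≐ t)  = _ , here refl
Alt-nonempty ⊥'       = _ , here refl
Alt-nonempty (φ ∧' ψ) = _ , ∈-++⁺ˡ (proj₂ (Alt-nonempty φ))
Alt-nonempty (φ ∨' ψ) = _ , ∈-++⁺ˡ (proj₂ (Alt-nonempty φ))
Alt-nonempty (φ ⇒' ψ) = _ , ∈-++⁺ʳ (map perp (Alt φ)) (proj₂ (Alt-nonempty ψ))
Alt-nonempty (∀' φ)   = _ , ∈-map⁺ (addHead ⊖) (proj₂ (Alt-nonempty φ))
Alt-nonempty (∃' φ)   = _ , ∈-map⁺ (addHead ⊕) (proj₂ (Alt-nonempty φ))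

length-addHead≰0 : ∀ c φ → ¬ All (λ s → length (addHead c s) ≤ 0) (Alt φ)
length-addHead≰0 c φ a =
  n≮0 (≤-trans (0<length-addHead c _) (All.lookup a (proj₂ (Alt-nonempty φ))))

-- The Gödel–Gentzen translation; prime formulas need no double negation since HA decides them.

N : Form → Form
N (s ≐ t)  = s ≐ t
N ⊥'       = ⊥'
N (φ ∧' ψ) = N φ ∧' N ψ
N (φ ∨' ψ) = ¬' (¬' (N φ ∨' N ψ))
N (φ ⇒' ψ) = N φ ⇒' N ψ
N (∀' φ)   = ∀' (N φ)
N (∃' φ)   = ¬' (¬' (∃' (N φ)))

N-subst : ∀ σ φ → N (subst σ φ) ≡ subst σ (N φ)
N-subst σ (s ≐ t)  = refl
N-subst σ ⊥'       = refl
N-subst σ (φ ∧' ψ) = cong₂ _∧'_ (N-subst σ φ) (N-subst σ ψ)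
N-subst σ (φ ∨' ψ) = cong₂ (λ a b → ¬' (¬' (a ∨' b))) (N-subst σ φ) (N-subst σ ψ)
N-subst σ (φ ⇒' ψ) = cong₂ _⇒'_ (N-subst σ φ) (N-subst σ ψ)
N-subst σ (∀' φ)   = cong ∀' (N-subst (lift σ) φ)
N-subst σ (∃' φ)   = cong (λ a → ¬' (¬' (∃' a))) (N-subst (lift σ) φ)

map-N-shift : ∀ Γ → map N (map shift Γ) ≡ map shift (map N Γ)
map-N-shift []      = refl
map-N-shift (φ ∷ Γ) = cong₂ _∷_ (N-subst _ φ) (map-N-shift Γ)

-- The negative translation in extensions of HA

module Arithmetic (S : Theory) (ha : ∀ φ → HAax φ → S ⊢ φ) where
  open Derived S

  decided-≐ : ∀ s t → Decided (s ≐ t)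
  decided-≐ s t = conv (cong (λ u → u ≐ t ∨' ¬' (u ≐ t)) (substT-shiftT s t))
                       (∀E t (∀E s (interpret ha eq-decided)))

  decided-QF : ∀ {φ} → QF φ → Decided φ
  decided-QF (qf≐ s t) = decided-≐ s t
  decided-QF qf⊥       = decided-⊥
  decided-QF (qf∧ p q) = decided-∧ (decided-QF p) (decided-QF q)
  decided-QF (qf∨ p q) = decided-∨ (decided-QF p) (decided-QF q)
  decided-QF (qf⇒ p q) = decided-⇒ (decided-QF p) (decided-QF q)

  stable-N : ∀ φ → Stable (N φ)
  stable-N (s ≐ t)  = decided-stable (decided-≐ s t)
  stable-N ⊥'       = decided-stable decided-⊥
  stable-N (φ ∧' ψ) = stable-∧ (stable-N φ) (stable-N ψ)
  stable-N (φ ∨' ψ) = stable-¬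
  stable-N (φ ⇒' ψ) = stable-⇒ (stable-N ψ)
  stable-N (∀' φ)   = stable-∀ (stable-N φ)
  stable-N (∃' φ)   = stable-¬

  HAax-N : ∀ {φ} → HAax φ → S ⊢ N φ
  HAax-N succ≠0       = ha _ succ≠0
  HAax-N succInj      = ha _ succInj
  HAax-N (projEq i)   = ha _ (projEq i)
  HAax-N (compEq f g) = ha _ (compEq f g)
  HAax-N (recEq₀ f g) = ha _ (recEq₀ f g)
  HAax-N (recEqS f g) = ha _ (recEqS f g)
  -- As `N` commutes with substitution, this is the induction axiom for `N φ` up to equality.
  HAax-N (ind φ)      =
    conv (cong₂ (λ a b → (a ∧' ∀' (N φ ⇒' b)) ⇒' ∀' (N φ))
                (≡.sym (N-subst _ φ)) (≡.sym (N-subst _ φ)))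
         (ha _ (ind (N φ)))

  -- Translated formulas are stable, which is what the eliminations of ∨ and ∃ require; excluded
  -- middle becomes the provable ¬¬(A ∨ ¬A).
  N-sound : ∀ {X} → (∀ φ → X φ → S ⊢ N φ) →
            ∀ {Γ φ} → (PA +ₜ X) ⊢ Γ ⇒ φ → S ⊢ map N Γ ⇒ N φ
  N-sound x (hyp i)             = hyp (∈-map⁺ N i)
  N-sound x (ax (inj₁ (haAx a))) = wk (HAax-N a)
  N-sound x (ax (inj₁ (lem φ))) = ⇒I (⇒E h0 (∨I₂ (⇒I (⇒E h1 (∨I₁ h0)))))
  N-sound x (ax (inj₂ a))       = wk (x _ a)
  N-sound x (⊥E d)              = ⊥E (N-sound x d)
  N-sound x (∧I d e)            = ∧I (N-sound x d) (N-sound x e)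
  N-sound x (∧E₁ d)             = ∧E₁ (N-sound x d)
  N-sound x (∧E₂ d)             = ∧E₂ (N-sound x d)
  N-sound x (∨I₁ d)             = mp ¬¬I (∨I₁ (N-sound x d))
  N-sound x (∨I₂ d)             = mp ¬¬I (∨I₂ (N-sound x d))
  N-sound x {φ = χ} (∨E d e f)  = ¬¬∨E (stable-N χ) (N-sound x d) (N-sound x e) (N-sound x f)
  N-sound x (⇒I d)              = ⇒I (N-sound x d)
  N-sound x (⇒E d e)            = ⇒E (N-sound x d) (N-sound x e)
  N-sound x {Γ} (∀I d)          = ∀I (≡.subst (S ⊢_⇒ _) (map-N-shift Γ) (N-sound x d))
  N-sound x (∀E {φ = φ} t d)    = conv (≡.sym (N-subst _ φ)) (∀E t (N-sound x d))
  N-sound x (∃I {φ = φ} t d)    = mp ¬¬I (∃I t (conv (N-subst _ φ) (N-sound x d)))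
  N-sound x {Γ} {χ} (∃E {φ = φ} d e) =
    ¬¬∃E (stable-N χ) (N-sound x d)
      (≡.subst (λ Δ → S ⊢ N φ ∷ Δ ⇒ shift (N χ)) (map-N-shift Γ) (conv (N-subst _ χ) (N-sound x e)))
  N-sound x (≐refl t)           = ≐refl t
  N-sound x (≐subst φ s t d e)  =
    conv (≡.sym (N-subst _ φ)) (≐subst (N φ) s t (N-sound x d) (conv (N-subst _ φ) (N-sound x e)))

  private variable
    φ ψ χ : Form

  -- The double negation in `N-Elim` accommodates unstable formulas. It does no harm in the premise
  -- of an implication, because translated conclusions are stable.
  N-Intro N-Elim : Form → Set
  N-Intro φ = S ⊢ φ ⇒' N φ
  N-Elim φ = S ⊢ N φ ⇒' ¬' (¬' φ)

  intro-∧ : N-Intro φ → N-Intro ψ → N-Intro (φ ∧' ψ)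
  intro-∧ d e = ⇒I (∧I (mp d (∧E₁ h0)) (mp e (∧E₂ h0)))

  intro-∨ : N-Intro φ → N-Intro ψ → N-Intro (φ ∨' ψ)
  intro-∨ d e = ⇒-trans (∨-mono d e) ¬¬I

  intro-∃ : N-Intro φ → N-Intro (∃' φ)
  intro-∃ d = ⇒-trans (∃-mono d) ¬¬I

  intro-⇒ : N-Elim φ → N-Intro ψ → N-Intro (φ ⇒' ψ)
  intro-⇒ {ψ = ψ} d e = ⇒I (⇒I (raa (stable-N ψ)
    (⇒E (mp d h1) (⇒I (⇒E h1 (mp e (⇒E h3 h0)))))))

  elim-∧ : N-Elim φ → N-Elim ψ → N-Elim (φ ∧' ψ)
  elim-∧ d e = ⇒I (⇒I (⇒E (mp d (∧E₁ h1)) (⇒I (⇒E (mp e (∧E₂ h2)) (⇒I (⇒E h2 (∧I h1 h0)))))))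

  elim-∨ : N-Elim φ → N-Elim ψ → N-Elim (φ ∨' ψ)
  elim-∨ d e = ⇒I (¬¬∨E stable-¬ h0 (mp (¬¬-mono (⇒I (∨I₁ h0))) (mp d h0))
                                    (mp (¬¬-mono (⇒I (∨I₂ h0))) (mp e h0)))

  elim-∃ : N-Elim φ → N-Elim (∃' φ)
  elim-∃ d = ⇒I (¬¬∃E stable-¬ h0 (mp (¬¬-mono (⇒I (∃I-var0 h0))) (mp d h0)))

  -- Double negations do not move out of a universal quantifier intuitionistically, so the body has
  -- to be stable.
  elim-∀ : Stable φ → N-Elim φ → N-Elim (∀' φ)
  elim-∀ s d = ⇒-trans (∀-mono (⇒-trans d s)) ¬¬I

  elim-⇒ : N-Intro φ → N-Elim ψ → N-Elim (φ ⇒' ψ)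
  elim-⇒ d e = ⇒I (⇒I (⇒E h0 (⇒I (⊥E (⇒E (mp e (⇒E h2 (mp d h0))) (⇒I (⇒E h2 (⇒I h1))))))))

  mutual
    intro-QF : QF φ → N-Intro φ
    intro-QF (qf≐ s t) = ⇒-refl
    intro-QF qf⊥       = ⇒-refl
    intro-QF (qf∧ p q) = intro-∧ (intro-QF p) (intro-QF q)
    intro-QF (qf∨ p q) = intro-∨ (intro-QF p) (intro-QF q)
    intro-QF (qf⇒ p q) = intro-⇒ (elim-QF p) (intro-QF q)

    elim-QF : QF φ → N-Elim φ
    elim-QF (qf≐ s t) = ¬¬I
    elim-QF qf⊥       = ¬¬I
    elim-QF (qf∧ p q) = elim-∧ (elim-QF p) (elim-QF q)
    elim-QF (qf∨ p q) = elim-∨ (elim-QF p) (elim-QF q)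
    elim-QF (qf⇒ p q) = elim-⇒ (intro-QF p) (elim-QF q)

  mutual
    -- Universal quantifiers are the only obstacle; `stable-Π` supplies the stability of their
    -- bodies.
    elim-Σ : ∀ k {φ} → ProvesDNE (Σₖ k) S → Σₖ k φ → N-Elim φ
    elim-Σ zero    dne (Σ0 q) = elim-QF q
    elim-Σ (suc k) dne (Σπ p) = elim-Π k (ProvesDNE-pred dne) (Π-suc p)
    elim-Σ (suc k) dne (Σ∃ p) = elim-∃ (elim-Σ (suc k) dne p)

    elim-Π : ∀ k {φ} → ProvesDNE (Σₖ k) S → Πₖ (suc k) φ → N-Elim φ
    elim-Π k dne (Πσ p) = elim-Σ k dne p
    elim-Π k dne (Π∀ p) = elim-∀ (stable-Π dne p) (elim-Π k dne p)

  -- Consequences of the constant domain rule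

  module _ {k} (cd : CD-R (Πₖ (suc k)) S) where
    lem-QF : QF φ → S ⊢ φ ∨' dual φ
    lem-QF {φ} q = conv (cong (φ ∨'_) (≡.sym (dual-QF q))) (decided-QF q)

    mutual
      lem-Σ : ∀ {j φ} → j ≤′ k → Σₖ j φ → S ⊢ φ ∨' dual φ
      lem-Σ l (Σ0 q) = lem-QF q
      lem-Σ l (Σπ p) = lem-Π (≤′-pred l) p
      -- Both disjuncts have level at most k and are raised to Π_{k+1}, the class of the rule.
      lem-Σ l (Σ∃ p) = cd _ _ (Πσ (Σ-mono l (Σ∃ p))) (Π-suc (Π-mono l (Σ-dual p)))
        (∀I (⇒E (∨-mono (⇒I (∃I-var0 h0)) ⇒-refl) (lem-Σ l p)))

      lem-Π : ∀ {j φ} → j ≤′ k → Πₖ j φ → S ⊢ φ ∨' dual φ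
      lem-Π l (Π0 q) = lem-QF q
      lem-Π l (Πσ p) = lem-Σ (≤′-pred l) p
      lem-Π l (Π∀ p) = ⇒E (proj₁ ∨-comm)
        (cd _ _ (Πσ (Σ-mono l (Σ∃ (Π-dual p)))) (Π-suc (Π-mono l p))
          (∀I (⇒E (proj₁ ∨-comm) (⇒E (∨-mono ⇒-refl (⇒I (∃I-var0 h0))) (lem-Π l p)))))

    private
      stable-Σ∨Σ : Σₖ k φ → Σₖ k ψ → Stable (φ ∨' ψ)
      stable-Σ∨Σ p q = decided-stable
        (decided-∨ (dual-decided (lem-Σ ≤′-refl p)) (dual-decided (lem-Σ ≤′-refl q)))

      -- Universal quantifiers are stripped inside the double negation and restored outside by the
      -- rule, one at a time, until two decided Σ_k disjuncts remain.
      dne-Σ∨Π : Σₖ k φ → Πₖ (suc k) ψ → S ⊢ ¬' (¬' (φ ∨' ψ)) → S ⊢ φ ∨' ψ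
      dne-Σ∨Π p (Πσ q) d = ⇒E (stable-Σ∨Σ p q) d
      dne-Σ∨Π p (Π∀ q) d = cd _ _ (Πσ p) q (∀I (dne-Σ∨Π (Σ-subst _ p) q
        (⇒E (¬¬-mono (∨-mono ⇒-refl (⇒I (∀E-var0 h0)))) (⊢-subst _ d))))

      dne-Π∨Π : Πₖ (suc k) φ → Πₖ (suc k) ψ → S ⊢ ¬' (¬' (φ ∨' ψ)) → S ⊢ φ ∨' ψ
      dne-Π∨Π (Πσ p) q d = dne-Σ∨Π p q d
      dne-Π∨Π (Π∀ p) q d = ⇒E (proj₁ ∨-comm) (cd _ _ q p (∀I (⇒E (proj₁ ∨-comm)
        (dne-Π∨Π p (Π-subst _ q)
          (⇒E (¬¬-mono (∨-mono (⇒I (∀E-var0 h0)) ⇒-refl)) (⊢-subst _ d))))))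

    CD-R⇒DNE-R : DNE-R (Π∨Π (suc k)) S
    CD-R⇒DNE-R _ (π∨π p q) = dne-Π∨Π p q

  DMLD-R⇒DNE-R : ∀ {k} → DMLD-R (Σₖ k) S → DNE-R (Π∨Π k) S
  DMLD-R⇒DNE-R dmld _ (π∨π {φ} {ψ} p q) d =
    -- The rule is applied to the two duals, which cannot both hold, and its conclusion is dualised
    -- back.
    ⇒E (∨-mono (dual-dual-Π decided-QF p) (dual-dual-Π decided-QF q))
       (dmld _ _ (Π-dual p) (Π-dual q) (⇒E (contra both) d))
    where
    both : S ⊢ dual φ ∧' dual ψ ⇒' ¬' (φ ∨' ψ)
    both = ⇒I (⇒I (∨E h0 (⇒E (mp (dual⇒¬ φ) (∧E₁ h2)) h0) (⇒E (mp (dual⇒¬ ψ) (∧E₂ h2)) h0)))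

  -- Prenex forms and the translation for formulas of bounded degree

  module Decidable {k}
    (lem-Σ : ∀ {φ} → Σₖ k φ → S ⊢ φ ∨' dual φ)
    (lem-Π : ∀ {φ} → Πₖ k φ → S ⊢ φ ∨' dual φ) where

    complement-Σ : ∀ {j} → j ≤′ k → Σₖ j φ → Complement φ (dual φ)
    complement-Σ l p = complement-dual (lem-Σ (Σ-mono l p))

    complement-Π : ∀ {j} → j ≤′ k → Πₖ j φ → Complement φ (dual φ)
    complement-Π l p = complement-dual (lem-Π (Π-mono l p))

    decided-Σ : ∀ {j} → j ≤′ k → Σₖ j φ → Decided φ
    decided-Σ l p = dual-decided (lem-Σ (Σ-mono l p))

    decided-Π : ∀ {j} → j ≤′ k → Πₖ j φ → Decided φ
    decided-Π l p = dual-decided (lem-Π (Π-mono l p))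

    ∈Σ ∈Π : ℕ → Form → Set
    ∈Σ j φ = ∃[ χ ] Σₖ j χ × (χ ⟺ φ)
    ∈Π j φ = ∃[ χ ] Πₖ j χ × (χ ⟺ φ)

    mutual
      -- The outer block of the left disjunct is pulled out, then that of the right, and the level
      -- drops. Pulling out ∀ requires the other disjunct to be decided, hence the bound by k.
      Π-∨ : ∀ j {φ ψ} → j ≤′ k → Πₖ j φ → Πₖ j ψ → ∈Π j (φ ∨' ψ)
      Π-∨ zero    l (Π0 p) (Π0 q) = _ , Π0 (qf∨ p q) , ⟺-refl
      Π-∨ (suc j) l (Π∀ p) q with Π-∨ (suc j) l p (Π-subst _ q)
      ... | χ , r , e = ∀' χ , Π∀ r , ⟺-trans (∀-cong e) (∀-∨ˡ (decided-Π l q))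
      Π-∨ (suc j) l (Πσ p) q = Σ-Π-∨ j l p q

      Σ-Π-∨ : ∀ j {φ ψ} → suc j ≤′ k → Σₖ j φ → Πₖ (suc j) ψ → ∈Π (suc j) (φ ∨' ψ)
      Σ-Π-∨ j l p (Πσ q) with Σ-∨ j (≤′-pred l) p q
      ... | χ , r , e = χ , Πσ r , e
      Σ-Π-∨ j l p (Π∀ q) with Σ-Π-∨ j l (Σ-subst _ p) q
      ... | χ , r , e = ∀' χ , Π∀ r ,
        ⟺-trans (∀-cong (⟺-trans e ∨-comm)) (⟺-trans (∀-∨ˡ (decided-Σ (≤′-pred l) p)) ∨-comm)

      Σ-∨ : ∀ j {φ ψ} → j ≤′ k → Σₖ j φ → Σₖ j ψ → ∈Σ j (φ ∨' ψ)
      Σ-∨ zero    l (Σ0 p) (Σ0 q) = _ , Σ0 (qf∨ p q) , ⟺-refl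
      Σ-∨ (suc j) l (Σ∃ p) q with Σ-∨ (suc j) l p (Σ-subst _ q)
      ... | χ , r , e = ∃' χ , Σ∃ r , ⟺-trans (∃-cong e) ∃-∨ˡ
      Σ-∨ (suc j) l (Σπ p) q = Π-Σ-∨ j l p q

      Π-Σ-∨ : ∀ j {φ ψ} → suc j ≤′ k → Πₖ j φ → Σₖ (suc j) ψ → ∈Σ (suc j) (φ ∨' ψ)
      Π-Σ-∨ j l p (Σπ q) with Π-∨ j (≤′-pred l) p q
      ... | χ , r , e = χ , Σπ r , e
      Π-Σ-∨ j l p (Σ∃ q) with Π-Σ-∨ j l (Π-subst _ p) q
      ... | χ , r , e = ∃' χ , Σ∃ r ,
        ⟺-trans (∃-cong (⟺-trans e ∨-comm)) (⟺-trans ∃-∨ˡ ∨-comm)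

    ∈Π-∨ : ∀ {j} → j ≤′ k → ∈Π j φ → ∈Π j ψ → ∈Π j (φ ∨' ψ)
    ∈Π-∨ l (_ , p , d) (_ , q , e) with Π-∨ _ l p q
    ... | χ , r , f = χ , r , ⟺-trans f (∨-cong d e)

    ∈Σ-∨ : ∀ {j} → j ≤′ k → ∈Σ j φ → ∈Σ j ψ → ∈Σ j (φ ∨' ψ)
    ∈Σ-∨ l (_ , p , d) (_ , q , e) with Σ-∨ _ l p q
    ... | χ , r , f = χ , r , ⟺-trans f (∨-cong d e)

    -- The conjunction and the dual of a prenex form of the disjunction of duals are complements of
    -- equivalent formulas, hence equivalent.
    ∈Π-∧ : ∀ {j} → j ≤′ k → ∈Π j φ → ∈Π j ψ → ∈Π j (φ ∧' ψ)
    ∈Π-∧ l (_ , p , d) (_ , q , e) with Σ-∨ _ l (Π-dual p) (Π-dual q)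
    ... | χ , r , f = dual χ , Σ-dual r , ⟺-trans
      (complement-unique (complement-sym (complement-Σ l r))
                         (complement-∧ (complement-Π l p) (complement-Π l q)) f)
      (∧-cong d e)

    ∈Σ-∧ : ∀ {j} → j ≤′ k → ∈Σ j φ → ∈Σ j ψ → ∈Σ j (φ ∧' ψ)
    ∈Σ-∧ l (_ , p , d) (_ , q , e) with Π-∨ _ l (Σ-dual p) (Σ-dual q)
    ... | χ , r , f = dual χ , Π-dual r , ⟺-trans
      (complement-unique (complement-sym (complement-Π l r))
                         (complement-∧ (complement-Σ l p) (complement-Σ l q)) f)
      (∧-cong d e)

    ∈Π-⇒ : ∀ {j} → j ≤′ k → ∈Σ j φ → ∈Π j ψ → ∈Π j (φ ⇒' ψ)
    ∈Π-⇒ l (_ , p , d) (_ , q , e) with Π-∨ _ l (Σ-dual p) q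
    ... | χ , r , f = χ , r ,
      ⟺-trans f (⟺-trans (complement-⇒ (complement-Σ l p)) (⇒-cong d e))

    ∈Σ-⇒ : ∀ {j} → j ≤′ k → ∈Π j φ → ∈Σ j ψ → ∈Σ j (φ ⇒' ψ)
    ∈Σ-⇒ l (_ , p , d) (_ , q , e) with Σ-∨ _ l (Π-dual p) q
    ... | χ , r , f = χ , r ,
      ⟺-trans f (⟺-trans (complement-⇒ (complement-Π l p)) (⇒-cong d e))

    QF∈Π : ∀ j → QF φ → ∈Π j φ
    QF∈Π j q = _ , Π-mono (z≤′n {j}) (Π0 q) , ⟺-refl

    QF∈Σ : ∀ j → QF φ → ∈Σ j φ
    QF∈Σ j q = _ , Σ-mono (z≤′n {j}) (Σ0 q) , ⟺-refl

    mutual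
      prenex-U : ∀ φ j → j ≤′ k → All (U j) (Alt φ) → ∈Π j φ
      prenex-U (s ≐ t)  j l a = QF∈Π j (qf≐ s t)
      prenex-U ⊥'       j l a = QF∈Π j qf⊥
      prenex-U (φ ∧' ψ) j l a with Allₚ.++⁻ (Alt φ) a
      ... | b , c = ∈Π-∧ l (prenex-U φ j l b) (prenex-U ψ j l c)
      prenex-U (φ ∨' ψ) j l a with Allₚ.++⁻ (Alt φ) a
      ... | b , c = ∈Π-∨ l (prenex-U φ j l b) (prenex-U ψ j l c)
      prenex-U (φ ⇒' ψ) j l a with Allₚ.++⁻ (map perp (Alt φ)) a
      ... | b , c = ∈Π-⇒ l (prenex-E φ j l (All.map (U-perp j _) (Allₚ.map⁻ b))) (prenex-U ψ j l c)
      prenex-U (∀' φ)   j l a = prenex-∀ φ j l (All.map (U⇒length-⊖ j _) (Allₚ.map⁻ a))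
      prenex-U (∃' φ)   zero l a =
        ⊥-elim (length-addHead≰0 ⊕ φ (All.map (≤-trans (n≤1+n _) ∘ U⇒length-⊕ 0 _) (Allₚ.map⁻ a)))
      prenex-U (∃' φ)   (suc j) l a
        -- All paths are shorter than the level, so the formula is Σ one level down and joins Π
        -- through an empty block.
        with prenex-∃ φ j (≤′-pred l) (All.map (s≤s⁻¹ ∘ U⇒length-⊕ (suc j) _) (Allₚ.map⁻ a))
      ... | χ , r , e = χ , Πσ r , e

      prenex-E : ∀ φ j → j ≤′ k → All (E j) (Alt φ) → ∈Σ j φ
      prenex-E (s ≐ t)  j l a = QF∈Σ j (qf≐ s t)
      prenex-E ⊥'       j l a = QF∈Σ j qf⊥
      prenex-E (φ ∧' ψ) j l a with Allₚ.++⁻ (Alt φ) a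
      ... | b , c = ∈Σ-∧ l (prenex-E φ j l b) (prenex-E ψ j l c)
      prenex-E (φ ∨' ψ) j l a with Allₚ.++⁻ (Alt φ) a
      ... | b , c = ∈Σ-∨ l (prenex-E φ j l b) (prenex-E ψ j l c)
      prenex-E (φ ⇒' ψ) j l a with Allₚ.++⁻ (map perp (Alt φ)) a
      ... | b , c = ∈Σ-⇒ l (prenex-U φ j l (All.map (E-perp j _) (Allₚ.map⁻ b))) (prenex-E ψ j l c)
      prenex-E (∃' φ)   j l a = prenex-∃ φ j l (All.map (E⇒length-⊕ j _) (Allₚ.map⁻ a))
      prenex-E (∀' φ)   zero l a =
        ⊥-elim (length-addHead≰0 ⊖ φ (All.map (≤-trans (n≤1+n _) ∘ E⇒length-⊖ 0 _) (Allₚ.map⁻ a)))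
      prenex-E (∀' φ)   (suc j) l a
        with prenex-∀ φ j (≤′-pred l) (All.map (s≤s⁻¹ ∘ E⇒length-⊖ (suc j) _) (Allₚ.map⁻ a))
      ... | χ , r , e = χ , Σπ r , e

      prenex-∀ : ∀ φ j → j ≤′ k → All (λ s → length (addHead ⊖ s) ≤ j) (Alt φ) → ∈Π j (∀' φ)
      prenex-∀ φ zero    l a = ⊥-elim (length-addHead≰0 ⊖ φ a)
      prenex-∀ φ (suc j) l a with prenex-U φ (suc j) l (All.map (U-addHead⊖ (suc j) _) a)
      ... | χ , r , e = ∀' χ , Π∀ r , ∀-cong e

      prenex-∃ : ∀ φ j → j ≤′ k → All (λ s → length (addHead ⊕ s) ≤ j) (Alt φ) → ∈Σ j (∃' φ)
      prenex-∃ φ zero    l a = ⊥-elim (length-addHead≰0 ⊕ φ a)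
      prenex-∃ φ (suc j) l a with prenex-E φ (suc j) l (All.map (E-addHead⊕ (suc j) _) a)
      ... | χ , r , e = ∃' χ , Σ∃ r , ∃-cong e

    -- Decidedness is carried along to supply the stable bodies that `elim-∀` asks for.
    record Transparent (φ : Form) : Set where
      field
        decided : Decided φ
        intro   : N-Intro φ
        elim    : N-Elim φ
    open Transparent

    -- Propositional combinations may be neither Σ_k nor Π_k, so these are treated componentwise; a
    -- quantified formula is decided through its prenex form.
    bounded-transparent : ∀ φ → All (λ s → length s ≤ k) (Alt φ) → Transparent φ
    bounded-transparent (s ≐ t) a = record
      { decided = decided-≐ s t ; intro = ⇒-refl ; elim = ¬¬I }
    bounded-transparent ⊥' a = record
      { decided = decided-⊥ ; intro = ⇒-refl ; elim = ¬¬I }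
    bounded-transparent (φ ∧' ψ) a with Allₚ.++⁻ (Alt φ) a
    ... | b , c with bounded-transparent φ b | bounded-transparent ψ c
    ... | p | q = record
      { decided = decided-∧ (decided p) (decided q)
      ; intro = intro-∧ (intro p) (intro q) ; elim = elim-∧ (elim p) (elim q) }
    bounded-transparent (φ ∨' ψ) a with Allₚ.++⁻ (Alt φ) a
    ... | b , c with bounded-transparent φ b | bounded-transparent ψ c
    ... | p | q = record
      { decided = decided-∨ (decided p) (decided q)
      ; intro = intro-∨ (intro p) (intro q) ; elim = elim-∨ (elim p) (elim q) }
    bounded-transparent (φ ⇒' ψ) a with Allₚ.++⁻ (map perp (Alt φ)) a
    ... | b , c with bounded-transparent φ (All.map (λ {s} → ≡.subst (_≤ k) (length-map flipS s)) (Allₚ.map⁻ b))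
                   | bounded-transparent ψ c
    ... | p | q = record
      { decided = decided-⇒ (decided p) (decided q)
      ; intro = intro-⇒ (elim p) (intro q) ; elim = elim-⇒ (intro p) (elim q) }
    bounded-transparent (∀' φ) a with prenex-∀ φ k ≤′-refl (Allₚ.map⁻ a)
      | bounded-transparent φ (All.map (λ {s} → ≤-trans (length≤addHead ⊖ s)) (Allₚ.map⁻ a))
    ... | χ , r , e | p = record
      { decided = decided-cong e (decided-Π ≤′-refl r)
      ; intro = ∀-mono (intro p) ; elim = elim-∀ (decided-stable (decided p)) (elim p) }
    bounded-transparent (∃' φ) a with prenex-∃ φ k ≤′-refl (Allₚ.map⁻ a)
      | bounded-transparent φ (All.map (λ {s} → ≤-trans (length≤addHead ⊕ s)) (Allₚ.map⁻ a))
    ... | χ , r , e | p = record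
      { decided = decided-cong e (decided-Σ ≤′-refl r)
      ; intro = intro-∃ (intro p) ; elim = elim-∃ (elim p) }

    F⁺-transparent : F⁺ k φ → Transparent φ
    F⁺-transparent {φ} l = bounded-transparent φ (length≤ k (Alt φ) l)

    mutual
      -- Implication exchanges the two laws, so they are proved together. Beyond degree k, `𝓙` is
      -- not closed under ∀, the one connective whose elimination law needs stability.
      intro-𝓡 : 𝓡 (suc k) φ → N-Intro φ
      intro-𝓡 (Rdeg l) = intro (F⁺-transparent l)
      intro-𝓡 (R∧ p q) = intro-∧ (intro-𝓡 p) (intro-𝓡 q)
      intro-𝓡 (R∨ p q) = intro-∨ (intro-𝓡 p) (intro-𝓡 q)
      intro-𝓡 (R∀ p)   = ∀-mono (intro-𝓡 p)
      intro-𝓡 (R⇒ p q) = intro-⇒ (elim-𝓙 p) (intro-𝓡 q)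

      elim-𝓙 : 𝓙 (suc k) φ → N-Elim φ
      elim-𝓙 (Jdeg l) = elim (F⁺-transparent l)
      elim-𝓙 (J∧ p q) = elim-∧ (elim-𝓙 p) (elim-𝓙 q)
      elim-𝓙 (J∨ p q) = elim-∨ (elim-𝓙 p) (elim-𝓙 q)
      elim-𝓙 (J∃ p)   = elim-∃ (elim-𝓙 p)
      elim-𝓙 (J⇒ p q) = elim-⇒ (intro-𝓡 p) (elim-𝓙 q)

    intro-𝓠 : 𝓠 (suc k) φ → N-Intro φ
    intro-𝓠 (Qpr (pr≐ s t)) = ⇒-refl
    intro-𝓠 (Qpr pr⊥)       = ⇒-refl
    intro-𝓠 (Q∧ p q)        = intro-∧ (intro-𝓠 p) (intro-𝓠 q)
    intro-𝓠 (Q∨ p q)        = intro-∨ (intro-𝓠 p) (intro-𝓠 q)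
    intro-𝓠 (Q∀ p)          = ∀-mono (intro-𝓠 p)
    intro-𝓠 (Q∃ p)          = intro-∃ (intro-𝓠 p)
    intro-𝓠 (Q⇒ p q)        = intro-⇒ (elim-𝓙 p) (intro-𝓠 q)

-- Equivalence of conservativity with the closure rules

theorem5p19 : (k : ℕ) (T X : Theory) → SemiClassical T
    → (∀ φ → X φ → Sentence φ × 𝓠 (suc k) φ)
    → let TX = T +ₜ X
          s1 = Conservative (Π∨Π (suc k)) (PA +ₜ X) TX
          s2 = DNE-R (Π∨Π (suc k)) TX
          s3 = CD-R (Πₖ (suc k)) TX
          s4 = DMLD-R (Σₖ (suc k)) TX
          s5 = DML-R (Σₖ (suc k)) TX × ProvesDNE (Σₖ k) TX
      in (s1 ⇔ s2) × (s1 ⇔ s3) × (s1 ⇔ s4) × (s1 ⇔ s5)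
theorem5p19 k T X (HA⊆T , T⊆PA) X⊆𝓠 =
    mk⇔ 1⇒2 2⇒1
  , mk⇔ (DNE-R⇒CD-R ∘ 1⇒2) (2⇒1 ∘ CD-R⇒DNE-R)
  , mk⇔ 1⇒4 4⇒1
  , mk⇔ 1⇒5 (4⇒1 ∘ 5⇒4)
  where
  TX PAX : Theory
  TX  = T +ₜ X
  PAX = PA +ₜ X

  HA⊆TX : ∀ φ → HAax φ → TX ⊢ φ
  HA⊆TX φ a = interpret (λ _ → ax ∘ inj₁) (HA⊆T φ (ax a))

  TX⊆PAX : ∀ {φ} → TX ⊢ φ → PAX ⊢ φ
  TX⊆PAX = interpret λ
    { φ (inj₁ t) → interpret (λ _ → ax ∘ inj₁) (T⊆PA φ (ax t))
    ; φ (inj₂ x) → ax (inj₂ x) }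

  open Derived TX
  open Arithmetic TX HA⊆TX
  module P = Derived PAX

  PAX-decided : ∀ φ → P.Decided φ
  PAX-decided φ = ax (inj₁ (lem φ))

  PAX-¬⇒dual : ∀ {φ} → Σₖ (suc k) φ → PAX ⊢ ¬' φ ⇒' dual φ
  PAX-¬⇒dual = P.¬⇒dual-Σ k (λ φ _ → P.decided-stable (PAX-decided φ))

  1⇒2 : Conservative (Π∨Π (suc k)) PAX TX → DNE-R (Π∨Π (suc k)) TX
  1⇒2 con φ p d = con φ p (⇒E (P.decided-stable (PAX-decided φ)) (TX⊆PAX d))

  2⇒1 : DNE-R (Π∨Π (suc k)) TX → Conservative (Π∨Π (suc k)) PAX TX
  2⇒1 dne _ (π∨π p q) d = dne _ (π∨π p q)
    -- The translated classical proof ends in the translated disjunction, which `elim-∨` turns into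
    -- the doubly negated original.
    (⇒E (elim-∨ (elim-Π k dne-Σ p) (elim-Π k dne-Σ q)) (N-sound X-N d))
    where
    cd : CD-R (Πₖ (suc k)) TX
    cd = DNE-R⇒CD-R dne

    dne-Σ : ProvesDNE (Σₖ k) TX
    dne-Σ φ p = decided-stable (dual-decided (lem-Σ cd ≤′-refl p))

    open Decidable {k} (lem-Σ cd ≤′-refl) (lem-Π cd ≤′-refl)

    X-N : ∀ φ → X φ → TX ⊢ N φ
    X-N φ x = ⇒E (intro-𝓠 (proj₂ (X⊆𝓠 φ x))) (ax (inj₂ x))

  1⇒4 : Conservative (Π∨Π (suc k)) PAX TX → DMLD-R (Σₖ (suc k)) TX
  1⇒4 con φ ψ p q d = con _ (π∨π (Σ-dual p) (Σ-dual q))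
    (⇒E (P.∨-mono (PAX-¬⇒dual p) (PAX-¬⇒dual q))
        -- Classically, φ either fails or refutes ψ; the negations then become duals in Π_{k+1}.
        (∨E (PAX-decided φ) (∨I₂ (⇒I (P.mp (TX⊆PAX d) (∧I P.h1 P.h0)))) (∨I₁ P.h0)))

  4⇒1 : DMLD-R (Σₖ (suc k)) TX → Conservative (Π∨Π (suc k)) PAX TX
  4⇒1 = 2⇒1 ∘ DMLD-R⇒DNE-R

  1⇒5 : Conservative (Π∨Π (suc k)) PAX TX → DML-R (Σₖ (suc k)) TX × ProvesDNE (Σₖ k) TX
  1⇒5 con =
      (λ φ ψ p q d → ⇒E (∨-mono (dual⇒¬ φ) (dual⇒¬ ψ)) (1⇒4 con φ ψ p q d))
    -- For φ in Σ_k the disjunction φ ∨ φ^⊥ belongs to the conserved class, so φ is decided.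
    , (λ φ p → decided-stable (dual-decided (con _ (π∨π (Πσ p) (Π-suc (Σ-dual p)))
        (⇒E (P.∨-mono P.⇒-refl (PAX-¬⇒dual (Σ-suc p))) (PAX-decided φ)))))

  5⇒4 : DML-R (Σₖ (suc k)) TX × ProvesDNE (Σₖ k) TX → DMLD-R (Σₖ (suc k)) TX
  5⇒4 (dml , dne) φ ψ p q d = ⇒E (∨-mono (¬⇒dual-Σ k dne p) (¬⇒dual-Σ k dne q)) (dml φ ψ p q d)
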